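{- For every integer $n \geq 10$, it holds that $\mathrm{WL}_1(n) \in \{n-2, n-1\}$.
   Context: All graphs are finite, simple and undirected. Colour Refinement on a graph $G$ (with monochromatic initial colouring) computes colourings $\chi^i_G$: $\chi^0_G$ is constant, and for $i \geq 1$, $\chi^i_G(v) = \big(\chi^{i-1}_G(v), \{\!\{\chi^{i-1}_G(w) \mid w \in N(v)\}\!\}\big)$, where $N(v)$ is the neighbourhood of $v$ and $\{\!\{\cdot\}\!\}$ denotes a multiset. Let $\pi^i_G$ be the partition of $V(G)$ into colour classes of $\chi^i_G$. $\mathrm{WL}_1(G)$ is the least $j \geq 0$ such that $\pi^j_G = \pi^{j+1}_G$, and for $n \in \mathbb{N}$, $\mathrm{WL}_1(n)$ is the maximum of $\mathrm{WL}_1(G)$ over all graphs $G$ with $n$ vertices. -}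

module Defs where

open import Data.Nat using (ℕ; zero; suc; _≤_; _<_; _≡ᵇ_)
open import Data.Bool using (Bool; true; false; _∧_; if_then_else_)
open import Data.Fin using (Fin)
open import Data.List using (List; []; _∷_; length; filterᵇ)
open import Data.List.Base using (allFin)
open import Data.Product using (Σ; ∃; ∃-syntax; _×_)
open import Relation.Binary.PropositionalEquality using (_≡_)
open import Relation.Nullary using (¬_)

allᵇ : ∀ {A : Set} → (A → Bool) → List A → Bool
allᵇ p []       = true
allᵇ p (x ∷ xs) = p x ∧ allᵇ p xs

record Graph (n : ℕ) : Set where
  field
    adj    : Fin n → Fin n → Bool
    sym    : ∀ u v → adj u v ≡ adj v u
    irrefl : ∀ v → adj v v ≡ false
open Graph public

-- sameColour G i v w = true  iff  χ^i_G(v) = χ^i_G(w),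
-- i.e. v and w lie in the same class of the partition π^i_G.
-- χ^0 is constant; χ^{i+1}(v) = χ^{i+1}(w) iff χ^i(v) = χ^i(w) and the
-- multisets {{χ^i(x) | x ∈ N(v)}} and {{χ^i(x) | x ∈ N(w)}} coincide,
-- i.e. for every colour class (represented by a vertex u) v and w have
-- the same number of neighbours of that colour.
mutual
  sameColour : ∀ {n} → Graph n → ℕ → Fin n → Fin n → Bool
  sameColour G zero    v w = true
  sameColour {n} G (suc i) v w =
    sameColour G i v w ∧
    allᵇ (λ u → nbCount G i v u ≡ᵇ nbCount G i w u) (allFin n)

  nbCount : ∀ {n} → Graph n → ℕ → Fin n → Fin n → ℕ
  nbCount {n} G i v u =
    length (filterᵇ (λ x → adj G v x ∧ sameColour G i x u) (allFin n))

Stable : ∀ {n} → Graph n → ℕ → Set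
Stable G j = ∀ v w → sameColour G j v w ≡ sameColour G (suc j) v w

IsWL1 : ∀ {n} → Graph n → ℕ → Set
IsWL1 G j = Stable G j × (∀ i → i < j → ¬ Stable G i)

IsWL1Max : ℕ → ℕ → Set
IsWL1Max n k = (∃[ G ] IsWL1 {n} G k) × (∀ (G : Graph n) j → IsWL1 G j → j ≤ k)

{-# OPTIONS --safe #-}
-- A partition that is refined strictly in every round gains a class per round, so at most n - 1 rounds
-- are possible; whether some graph attains n - 1 is decided by exhaustive search. It remains to find,
-- for each n ≥ 10, a graph that is still unstable after n - 3 rounds.
--
-- For n ≥ 14 the vertices come in pairs that form a path, consecutive pairs being joined by a matching.
-- The path runs down an arm M, up an arm L, through a pair C and down an arm R; the depth of a pair is
-- its distance from the bottom of its arm. Most pairs carry an inner edge, and the pairs at the bottom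
-- are recognised by their degree, or by a hub vertex if n is odd. The two vertices at the start of the
-- path (the top of M) are joined to both top vertices of L, respectively of R. Refinement first finds
-- the depths, one per round; this isolates the start of the path, whose two vertices have the same
-- degree into the class formed by the tops of L and R. A wave along the path then separates M from L
-- and L from R. Once it has separated the tops of L and R, the pair at the start splits, and a second
-- wave along the path splits all other pairs, one per round. Lengths m, r, r of the arms with
-- |m - r| ≤ 1 cover all n, and at most one round is lost.

module Submission where

open import Defs
open import Data.Bool using (Bool; true; false; _∧_; not; T; T?; _∨_)
import Data.Bool.Properties as Bool
open import Data.Empty using (⊥; ⊥-elim)
open import Data.Fin using (Fin; zero; suc; combine; toℕ; #_; fromℕ<)
open import Data.Fin.Patterns using (0F; 1F; 2F; 3F)
import Data.Fin.Properties as Fin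
open import Data.Fin.Subset using (Subset)
open import Data.Fin.Subset.Properties using (anySubset?)
open import Data.List using (List; []; _∷_; length; filterᵇ; allFin; map; tabulate)
import Data.List.Membership.DecPropositional as DecMembership
open import Data.List.Membership.Propositional using (_∈_; _∉_)
open import Data.List.Membership.Propositional.Properties using (∈-allFin; ∈-filter⁺; ∈-filter⁻; ∈-map⁺; ∈-map⁻)
open import Data.List.Membership.Propositional.Properties.WithK using (unique∧set⇒bag)
open import Data.List.Properties using (length-map; ∷-injectiveˡ; ∷-injectiveʳ; map-tabulate)
open import Data.List.Relation.Binary.BagAndSetEquality using (∼bag⇒↭)
open import Data.List.Relation.Binary.Permutation.Propositional using (_↭_)
open import Data.List.Relation.Binary.Permutation.Propositional.Properties using (filter-↭; ↭-length)
open import Data.List.Relation.Binary.Pointwise using (Pointwise; []; _∷_)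
import Data.List.Relation.Binary.Pointwise as Pointwise
open import Data.List.Relation.Unary.All using (All; []; _∷_)
import Data.List.Relation.Unary.All as All
import Data.List.Relation.Unary.All.Properties as All
open import Data.List.Relation.Unary.AllPairs using ([]; _∷_)
open import Data.List.Relation.Unary.Any using (here; there)
open import Data.List.Relation.Unary.Unique.Propositional using (Unique)
import Data.List.Relation.Unary.Unique.Propositional.Properties as Unique
open import Data.Nat using (ℕ; zero; suc; _≤_; _<_; _≡ᵇ_; _*_; _∸_; z≤n; s≤s; _+_; _≤?_)
open import Data.Nat.DivMod using (_divMod_; result)
import Data.Nat.Properties as ℕ
open import Data.Nat.Solver using (module +-*-Solver)
open import Data.Product using (∃-syntax; Σ-syntax; _×_; _,_; proj₁; proj₂; uncurry)
open import Data.Product.Function.NonDependent.Propositional using (_×-↔_)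
open import Data.Sum using (_⊎_; inj₁; inj₂)
import Data.Sum as Sum
open import Data.Sum.Function.Propositional using (_⊎-↔_)
open import Data.Vec using (Vec; lookup)
import Data.Vec as Vec
open import Data.Vec.Properties using (lookup∘tabulate)
open import Function using (_∘_; Equivalence; mk⇔; Inverse; _↔_; mk↔ₛ′)
open import Function.Construct.Composition using (_↔-∘_)
open import Function.Construct.Identity using (↔-id)
open import Function.Construct.Symmetry using (↔-sym)
open import Function.Properties.Inverse using (Inverse⇒Injection)
open import Relation.Binary.Definitions using (DecidableEquality)
open import Relation.Binary.PropositionalEquality using (_≡_; _≢_; refl; trans; cong; cong₂; subst)
import Relation.Binary.PropositionalEquality as Eq
open import Relation.Nullary using (¬_; Dec; yes; no; contradiction; does)
open import Relation.Nullary.Decidable using (map′; _×-dec_; ¬?; decidable-stable; dec-true; dec-false; recompute)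

-- Boolean tests and filters on lists

allᵇ⁻ : ∀ {A : Set} (p : A → Bool) {xs x} → allᵇ p xs ≡ true → x ∈ xs → p x ≡ true
allᵇ⁻ p {y ∷ xs} h (here refl) = Bool.∧-conicalˡ (p y) _ h
allᵇ⁻ p {y ∷ xs} h (there x∈)  = allᵇ⁻ p (Bool.∧-conicalʳ (p y) _ h) x∈

allᵇ⁺ : ∀ {A : Set} (p : A → Bool) xs → (∀ x → p x ≡ true) → allᵇ p xs ≡ true
allᵇ⁺ p []       h = refl
allᵇ⁺ p (x ∷ xs) h = cong₂ _∧_ (h x) (allᵇ⁺ p xs h)

allᵇ-cong : ∀ {A : Set} {p q : A → Bool} xs → (∀ x → p x ≡ q x) → allᵇ p xs ≡ allᵇ q xs
allᵇ-cong []       h = refl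
allᵇ-cong (x ∷ xs) h = cong₂ _∧_ (h x) (allᵇ-cong xs h)

length-filterᵇ-Pointwise : ∀ {A B : Set} {p : A → Bool} {q : B → Bool} {xs ys} →
  Pointwise (λ x y → p x ≡ q y) xs ys → length (filterᵇ p xs) ≡ length (filterᵇ q ys)
length-filterᵇ-Pointwise [] = refl
length-filterᵇ-Pointwise {p = p} {q} {x ∷ _} {y ∷ _} (e ∷ es) with p x | q y | e
... | true  | true  | refl = cong suc (length-filterᵇ-Pointwise es)
... | false | false | refl = length-filterᵇ-Pointwise es

Pointwise-diag : ∀ {A : Set} {R : A → A → Set} xs → (∀ x → R x x) → Pointwise R xs xs
Pointwise-diag []       r = []
Pointwise-diag (x ∷ xs) r = r x ∷ Pointwise-diag xs r

filterᵇ-∧ : ∀ {A : Set} (p q : A → Bool) xs → filterᵇ (λ x → p x ∧ q x) xs ≡ filterᵇ q (filterᵇ p xs)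
filterᵇ-∧ p q [] = refl
filterᵇ-∧ p q (x ∷ xs) with p x
... | false = filterᵇ-∧ p q xs
... | true with q x
...   | true  = cong (x ∷_) (filterᵇ-∧ p q xs)
...   | false = filterᵇ-∧ p q xs

T⇒≡true : ∀ {b} → T b → b ≡ true
T⇒≡true = Equivalence.to Bool.T-≡

≡true⇒T : ∀ {b} → b ≡ true → T b
≡true⇒T = Equivalence.from Bool.T-≡

-- Colour refinement: the rounds as equivalence relations

module _ {n} (G : Graph n) where

  -- A record rather than the bare equation, since `sameColour` computes and would hide the round
  -- and the vertices from unification.
  record Same (i : ℕ) (v w : Fin n) : Set where
    constructor same
    field colours : sameColour G i v w ≡ true

  open Same

  same? : ∀ i v w → Dec (Same i v w)
  same? i v w = map′ same colours (sameColour G i v w Bool.≟ true)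

  same-pred : ∀ i {v w} → Same (suc i) v w → Same i v w
  same-pred i (same s) = same (Bool.∧-conicalˡ _ _ s)

  same-mono : ∀ {i j v w} → i ≤ j → Same j v w → Same i v w
  same-mono {i} {j} i≤j s with ℕ.m≤n⇒m<n∨m≡n i≤j
  ... | inj₂ refl = s
  same-mono {i} {suc j} i≤j s | inj₁ (s≤s i≤j′) = same-mono i≤j′ (same-pred j s)

  same⇒count : ∀ i {v w} → Same (suc i) v w → ∀ u → nbCount G i v u ≡ nbCount G i w u
  same⇒count i {v} {w} (same s) u = ℕ.≡ᵇ⇒≡ _ _ (≡true⇒T
    (allᵇ⁻ (λ u → nbCount G i v u ≡ᵇ nbCount G i w u) {allFin n}
      (Bool.∧-conicalʳ (sameColour G i v w) _ s) (∈-allFin u)))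

  count⇒same : ∀ i {v w} → Same i v w → (∀ u → nbCount G i v u ≡ nbCount G i w u) → Same (suc i) v w
  count⇒same i (same s) h = same (cong₂ _∧_ s (allᵇ⁺ _ (allFin n) λ u → T⇒≡true (ℕ.≡⇒≡ᵇ _ _ (h u))))

  same-refl : ∀ i {v} → Same i v v
  same-refl zero    = same refl
  same-refl (suc i) = count⇒same i (same-refl i) λ _ → refl

  same-sym : ∀ i {v w} → Same i v w → Same i w v
  same-sym zero    s = same refl
  same-sym (suc i) s = count⇒same i (same-sym i (same-pred i s)) λ u → Eq.sym (same⇒count i s u)

  same-trans : ∀ i {u v w} → Same i u v → Same i v w → Same i u w
  same-trans zero    s t = same refl
  same-trans (suc i) s t = count⇒same i (same-trans i (same-pred i s) (same-pred i t))
    λ u → trans (same⇒count i s u) (same⇒count i t u)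

  same-congˡ : ∀ i {v w} → Same i v w → ∀ u → sameColour G i v u ≡ sameColour G i w u
  same-congˡ i {v} {w} s u = Bool.⇔→≡
    {sameColour G i v u} {sameColour G i w u} {true} (mk⇔
    (λ t → colours (same-trans i (same-sym i s) (same t))) (λ t → colours (same-trans i s (same t))))

  same-stable : ∀ {j} → Stable G j → ∀ {v w} → Same j v w → Same (suc j) v w
  same-stable st (same s) = same (trans (Eq.sym (st _ _)) s)

  neighbours : Fin n → List (Fin n)
  neighbours v = filterᵇ (adj G v) (allFin n)

  -- A matching of the two neighbourhoods that respects colours gives equal counts in every class,
  -- and counts do not depend on the order of the neighbours.
  same-suc : ∀ i {v w xs ys} → neighbours v ↭ xs → neighbours w ↭ ys →
    Same i v w → Pointwise (Same i) xs ys → Same (suc i) v w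
  same-suc i {v} {w} {xs} {ys} pv pw s ps = count⇒same i s λ u →
    trans (along u pv) (trans (length-filterᵇ-Pointwise (lemma u ps)) (Eq.sym (along u pw)))
    where
    along : ∀ u {v xs} → neighbours v ↭ xs →
      nbCount G i v u ≡ length (filterᵇ (λ x → sameColour G i x u) xs)
    along u {v} p = trans (cong length (filterᵇ-∧ (adj G v) _ (allFin n))) (↭-length (filter-↭ _ p))
    lemma : ∀ u {xs ys} → Pointwise (Same i) xs ys →
      Pointwise (λ x y → sameColour G i x u ≡ sameColour G i y u) xs ys
    lemma u []       = []
    lemma u (p ∷ ps) = same-congˡ i p u ∷ lemma u ps

  -- In round 0 all vertices have one colour, so `nbCount G 0` is the degree.
  same⇒degree : ∀ i {v w} → Same (suc i) v w → length (neighbours v) ≡ length (neighbours w)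
  same⇒degree zero    {v} {w} s = trans (Eq.sym (deg v)) (trans (same⇒count 0 s v) (deg w))
    where
    deg : ∀ x → nbCount G 0 x v ≡ length (neighbours x)
    deg x = length-filterᵇ-Pointwise (Pointwise-diag (allFin n) λ y → Bool.∧-identityʳ (adj G x y))
  same⇒degree (suc i) s = same⇒degree i (same-pred (suc i) s)

  -- The class of `x` contains a neighbour of `v`, namely `x` itself; equal counts force one at `w`.
  same⇒neighbour : ∀ i {v w x} → Same (suc i) v w → adj G v x ≡ true →
    ∃[ y ] (adj G w y ≡ true × Same i x y)
  same⇒neighbour i {v} {w} {x} s a = find
    (filterᵇ (λ y → adj G v y ∧ sameColour G i y x) (allFin n))
    (filterᵇ (λ y → adj G w y ∧ sameColour G i y x) (allFin n))
    (∈-filter⁺ (T? ∘ _) (∈-allFin x) (≡true⇒T (cong₂ _∧_ a (colours (same-refl i)))))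
    (same⇒count i s x)
    λ y∈ → T⇒≡true (proj₂ (∈-filter⁻ (T? ∘ _) {xs = allFin n} y∈))
    where
    find : ∀ xs ys → x ∈ xs → length xs ≡ length ys →
      (∀ {y} → y ∈ ys → adj G w y ∧ sameColour G i y x ≡ true) →
      ∃[ y ] (adj G w y ≡ true × Same i x y)
    find (_ ∷ _) (y ∷ _) _ _ f =
      y , Bool.∧-conicalˡ _ _ (f (here refl)) , same-sym i (same (Bool.∧-conicalʳ _ _ (f (here refl))))

  -- Unstable rounds and the number of colour classes

  stable? : ∀ j → Dec (Stable G j)
  stable? j = Fin.all? λ v → Fin.all? λ w → sameColour G j v w Bool.≟ sameColour G (suc j) v w

  unstable-pair : ∀ {j} → ¬ Stable G j → ∃[ v ] ∃[ w ] (Same j v w × ¬ Same (suc j) v w)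
  unstable-pair {j} ¬st with Fin.any? (λ v → Fin.any? (λ w →
    same? j v w ×-dec ¬? (same? (suc j) v w)))
  ... | yes p = p
  ... | no ¬p = contradiction stable ¬st
    where
    stable : Stable G j
    stable v w = Bool.⇔→≡ {sameColour G j v w} {sameColour G (suc j) v w} {true} (mk⇔
      (λ e → colours (decidable-stable (same? (suc j) v w) λ ¬s → ¬p (v , w , same e , ¬s)))
      (λ e → colours (same-pred j (same e))))

  -- Such an `f` witnesses at least `k` classes; representatives take the place of a count of the
  -- classes.
  Separated : ℕ → ∀ {k} → (Fin k → Fin n) → Set
  Separated i f = ∀ a b → a ≢ b → ¬ Same i (f a) (f b)

  extend : ∀ {k} → Fin n → (Fin k → Fin n) → Fin (suc k) → Fin n
  extend v f zero    = v
  extend v f (suc a) = f a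

  separated-extend : ∀ {i k v} {f : Fin k → Fin n} → Separated i f →
    (∀ a → ¬ Same i v (f a)) → Separated i (extend v f)
  separated-extend         sep new zero    zero    ne = contradiction refl ne
  separated-extend         sep new zero    (suc b) ne = new b
  separated-extend {i = i} sep new (suc a) zero    ne = new a ∘ same-sym i
  separated-extend         sep new (suc a) (suc b) ne = sep a b (ne ∘ cong suc)

  -- A class that splits contains at most one chosen vertex, and one of its parts contains none.
  separated-suc : ∀ {i k} {f : Fin k → Fin n} → ¬ Stable G i → Separated i f →
    ∃[ v ] Separated (suc i) (extend v f)
  separated-suc {i} {k} {f} ¬st sep with unstable-pair ¬st
  ... | v , w , s , ¬s with Fin.any? (λ a → same? i v (f a))
  ...   | no none = v , separated-extend sep′ λ a t → none (a , same-pred i t)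
    where
    sep′ : Separated (suc i) f
    sep′ a b ne t = sep a b ne (same-pred i t)
  ...   | yes (a , va) = pick (same? (suc i) v (f a))
    where
    sep′ : Separated (suc i) f
    sep′ a b ne t = sep a b ne (same-pred i t)
    other : ∀ u → Same i v u → ¬ Same (suc i) u (f a) → ∀ b → ¬ Same (suc i) u (f b)
    other u vu ¬ua b t with a Fin.≟ b
    ... | yes refl = ¬ua t
    ... | no a≢b   = sep a b a≢b
      (same-trans i (same-sym i va) (same-trans i vu (same-pred i t)))
    pick : Dec (Same (suc i) v (f a)) → ∃[ u ] Separated (suc i) (extend u f)
    pick (no ¬va)  = v , separated-extend sep′ (other v (same-refl i) ¬va)
    pick (yes va′) = w , separated-extend sep′ (other w s
      λ wa → ¬s (same-trans (suc i) va′ (same-sym (suc i) wa)))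

  -- There is one class at the start and one more after each unstable round.
  unstable⇒separated : Fin n → ∀ j → (∀ i → i < j → ¬ Stable G i) →
    ∃[ f ] Separated j {suc j} f
  unstable⇒separated v zero    h = (λ _ → v) , λ { zero zero ne → contradiction refl ne }
  unstable⇒separated v (suc j) h with unstable⇒separated v j (λ i i<j → h i (ℕ.m≤n⇒m≤1+n i<j))
  ... | f , sep with separated-suc (h j ℕ.≤-refl) sep
  ...   | u , sep′ = extend u f , sep′

  -- Representatives of different classes are different vertices, so `f` embeds `Fin (suc j)` into
  -- the vertex set.
  unstable⇒< : Fin n → ∀ j → (∀ i → i < j → ¬ Stable G i) → j < n
  unstable⇒< v j h with unstable⇒separated v j h
  ... | f , sep = Fin.injective⇒≤ {f = f} λ {a} {b} e → inj a b e
    where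
    inj : ∀ a b → f a ≡ f b → a ≡ b
    inj a b e with a Fin.≟ b
    ... | yes a≡b = a≡b
    ... | no  a≢b = ⊥-elim (sep a b a≢b (subst (Same j (f a)) e (same-refl j)))

  -- Testing the rounds in order makes the first stable one the least.
  WL1-search : ∀ j → (∃[ i ] IsWL1 G i) ⊎ (∀ i → i < j → ¬ Stable G i)
  WL1-search zero = inj₂ λ _ ()
  WL1-search (suc j) with WL1-search j
  ... | inj₁ found = inj₁ found
  ... | inj₂ h with stable? j
  ...   | yes st = inj₁ (j , st , h)
  ...   | no ¬st = inj₂ λ i i<1+j → case i (ℕ.m≤n⇒m<n∨m≡n (ℕ.≤-pred i<1+j))
    where
    case : ∀ i → i < j ⊎ i ≡ j → ¬ Stable G i
    case i (inj₁ i<j)  = h i i<j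
    case i (inj₂ refl) = ¬st

  WL1-exists : Fin n → ∃[ j ] IsWL1 G j
  WL1-exists v with WL1-search n
  ... | inj₁ found = found
  ... | inj₂ h     = contradiction (unstable⇒< v n h) (ℕ.<-irrefl refl)

  isWL1? : ∀ j → Dec (IsWL1 G j)
  isWL1? j = stable? j ×-dec map′ (λ f i → f {i}) (λ f {i} → f i)
    (ℕ.allUpTo? (λ i → ¬? (stable? i)) j)

-- Dependence on the adjacency function alone, and exhaustive search

module _ {n} (G H : Graph n) (adj≡ : ∀ u v → adj G u v ≡ adj H u v) where

  sameColour-cong : ∀ i v w → sameColour G i v w ≡ sameColour H i v w
  nbCount-cong : ∀ i v u → nbCount G i v u ≡ nbCount H i v u

  sameColour-cong zero    v w = refl
  sameColour-cong (suc i) v w = cong₂ _∧_ (sameColour-cong i v w)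
    (allᵇ-cong (allFin n) λ u → cong₂ _≡ᵇ_ (nbCount-cong i v u) (nbCount-cong i w u))

  nbCount-cong i v u = length-filterᵇ-Pointwise (Pointwise-diag (allFin n)
    λ x → cong₂ _∧_ (adj≡ v x) (sameColour-cong i x u))

  stable-cong : ∀ j → Stable G j → Stable H j
  stable-cong j st v w =
    trans (Eq.sym (sameColour-cong j v w)) (trans (st v w) (sameColour-cong (suc j) v w))

isWL1-cong : ∀ {n} (G H : Graph n) → (∀ u v → adj G u v ≡ adj H u v) → ∀ {j} → IsWL1 G j → IsWL1 H j
isWL1-cong G H e {j} (st , least) = stable-cong G H e j st ,
  λ i i<j st′ → least i i<j (stable-cong H G (λ u v → Eq.sym (e u v)) i st′)

-- An adjacency matrix is stored as the subset of its `n * n` cells that hold an edge, so that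
-- `anySubset?` ranges over all candidates.
module _ {n : ℕ} (M : Subset (n * n)) where

  entry : Fin n → Fin n → Bool
  entry u v = lookup M (combine u v)

  IsAdjacency : Set
  IsAdjacency = (∀ u v → entry u v ≡ entry v u) × (∀ v → entry v v ≡ false)

  isAdjacency? : Dec IsAdjacency
  isAdjacency? = (Fin.all? λ u → Fin.all? λ v → entry u v Bool.≟ entry v u)
    ×-dec (Fin.all? λ v → entry v v Bool.≟ false)

  fromMatrix : IsAdjacency → Graph n
  fromMatrix (s , i) = record { adj = entry ; sym = s ; irrefl = i }

toMatrix : ∀ {n} → Graph n → Subset (n * n)
toMatrix {n} G = Vec.tabulate (uncurry (adj G) ∘ Data.Fin.remQuot n)

entry-toMatrix : ∀ {n} (G : Graph n) u v → entry (toMatrix G) u v ≡ adj G u v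
entry-toMatrix G u v = trans (lookup∘tabulate _ (combine u v))
  (cong (uncurry (adj G)) (Fin.remQuot-combine u v))

∃WL1? : ∀ n j → Dec (∃[ G ] IsWL1 {n} G j)
∃WL1? n j with anySubset? P?
  where
  P : Subset (n * n) → Set
  P M = Σ[ a ∈ IsAdjacency M ] IsWL1 (fromMatrix M a) j
  P? : ∀ M → Dec (P M)
  P? M with isAdjacency? M
  ... | no ¬a = no (¬a ∘ proj₁)
  ... | yes a = map′ (a ,_)
    -- Two proofs of `IsAdjacency M` may differ, but the graphs built from them have the same
    -- adjacency function.
    (λ (a′ , w) → isWL1-cong (fromMatrix M a′) (fromMatrix M a) (λ _ _ → refl) w)
    (isWL1? (fromMatrix M a) j)
... | yes (M , a , w) = yes (fromMatrix M a , w)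
... | no ¬p = no λ (G , w) → ¬p (toMatrix G , adjacency G ,
  isWL1-cong G (fromMatrix (toMatrix G) (adjacency G)) (λ u v → Eq.sym (entry-toMatrix G u v)) w)
  where
  adjacency : ∀ G → IsAdjacency (toMatrix G)
  adjacency G =
    (λ u v → trans (entry-toMatrix G u v) (trans (Graph.sym G u v) (Eq.sym (entry-toMatrix G v u)))) ,
    (λ v → trans (entry-toMatrix G v v) (irrefl G v))

-- Whether some graph attains n ∸ 1 is decidable by exhaustive search; if none does, G attains n ∸ 2.
dichotomy : ∀ m (G : Graph (suc (suc m))) → (∀ i → i < m → ¬ Stable G i) →
  ∃[ k ] (IsWL1Max (suc (suc m)) k × (k ≡ m ⊎ k ≡ suc m))
dichotomy m G unst = case (∃WL1? (suc (suc m)) (suc m)) (WL1-exists G zero)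
  where
  below : ∀ (H : Graph (suc (suc m))) j → IsWL1 H j → j ≤ suc m
  below H j (_ , least) = ℕ.≤-pred (unstable⇒< H zero j least)
  case : Dec (∃[ H ] IsWL1 {suc (suc m)} H (suc m)) → ∃[ j ] IsWL1 G j →
    ∃[ k ] (IsWL1Max (suc (suc m)) k × (k ≡ m ⊎ k ≡ suc m))
  case (yes p) _ = suc m , (p , below) , inj₂ refl
  case (no ¬p) (j , w) = m , ((G , subst (IsWL1 G) j≡m w) , bound) , inj₁ refl
    where
    bound : ∀ (H : Graph (suc (suc m))) j → IsWL1 H j → j ≤ m
    bound H j w = ℕ.≤-pred (ℕ.≤∧≢⇒< (below H j w) λ j≡ → ¬p (H , subst (IsWL1 H) j≡ w))
    j≡m : j ≡ m
    j≡m = ℕ.≤-antisym (bound G j w) (ℕ.≮⇒≥ λ j<m → unst j j<m (proj₁ w))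

-- Graphs given by neighbour lists

does⇒ : ∀ {A : Set} (d : Dec A) → does d ≡ true → A
does⇒ (yes a) _ = a

module NeighbourLists {V : Set} {n : ℕ} (V↔Fin : V ↔ Fin n) (nbrs : V → List V)
  (nbrs-unique : ∀ v → Unique (nbrs v))
  (nbrs-sym : ∀ v {x} → x ∈ nbrs v → v ∈ nbrs x)
  (nbrs-irrefl : ∀ v → v ∉ nbrs v) where

  open Inverse V↔Fin using (to; from; strictlyInverseˡ; strictlyInverseʳ)

  to-injective : ∀ {v w} → to v ≡ to w → v ≡ w
  to-injective {v} {w} e =
    trans (Eq.sym (strictlyInverseʳ v)) (trans (cong from e) (strictlyInverseʳ w))

  _≟_ : DecidableEquality V
  _≟_ = Fin.inj⇒≟ (Inverse⇒Injection V↔Fin)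

  open DecMembership _≟_ using (_∈?_)

  does-cong : ∀ {A B : Set} (a? : Dec A) (b? : Dec B) → (A → B) → (B → A) → does a? ≡ does b?
  does-cong (yes a) b? f g = Eq.sym (dec-true b? (f a))
  does-cong (no ¬a) b? f g = Eq.sym (dec-false b? (¬a ∘ g))

  graph : Graph n
  graph = record
    { adj    = λ a b → does (from b ∈? nbrs (from a))
    ; sym    = λ a b → does-cong (from b ∈? nbrs (from a)) (from a ∈? nbrs (from b))
                 (nbrs-sym (from a)) (nbrs-sym (from b))
    ; irrefl = λ a → dec-false (from a ∈? nbrs (from a)) (nbrs-irrefl (from a))
    }

  -- Two duplicate-free lists with the same members are permutations of each other.
  neighbours-nbrs : ∀ v → neighbours graph (to v) ↭ map to (nbrs v)
  neighbours-nbrs v = ∼bag⇒↭ (unique∧set⇒bag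
    (Unique.filter⁺ (T? ∘ _) (Unique.allFin⁺ n))
    (Unique.map⁺ to-injective (nbrs-unique v))
    (mk⇔ sound complete))
    where
    sound : ∀ {a} → a ∈ neighbours graph (to v) → a ∈ map to (nbrs v)
    sound {a} a∈ = subst (_∈ map to (nbrs v)) (strictlyInverseˡ a) (∈-map⁺ to
      (subst (λ u → from a ∈ nbrs u) (strictlyInverseʳ v)
        (does⇒ (from a ∈? _) (T⇒≡true (proj₂ (∈-filter⁻ (T? ∘ _) {xs = allFin n} a∈))))))
    complete : ∀ {a} → a ∈ map to (nbrs v) → a ∈ neighbours graph (to v)
    complete {a} a∈ with ∈-map⁻ to a∈
    ... | x , x∈ , refl = ∈-filter⁺ (T? ∘ _) (∈-allFin (to x)) (≡true⇒T (dec-true (from (to x) ∈? _)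
      (Eq.subst₂ (λ y u → y ∈ nbrs u) (Eq.sym (strictlyInverseʳ x)) (Eq.sym (strictlyInverseʳ v)) x∈)))

  record Alike (i : ℕ) (v w : V) : Set where
    constructor alike
    field same-vertices : Same graph i (to v) (to w)

  open Alike

  alike-zero : ∀ {v w} → Alike 0 v w
  alike-zero = alike (same refl)

  alike-sym : ∀ {i v w} → Alike i v w → Alike i w v
  alike-sym {i} (alike s) = alike (same-sym graph i s)

  alike-mono : ∀ {i j v w} → i ≤ j → Alike j v w → Alike i v w
  alike-mono i≤j (alike s) = alike (same-mono graph i≤j s)

  alike-stable : ∀ {i v w} → Stable graph i → Alike i v w → Alike (suc i) v w
  alike-stable st (alike s) = alike (same-stable graph st s)

  -- This rule will show that vertices of the family stay together; the two facts after it, on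
  -- degrees and neighbours, will tell vertices apart.
  alike-suc : ∀ i {v w} → Alike i v w → Pointwise (Alike i) (nbrs v) (nbrs w) → Alike (suc i) v w
  alike-suc i {v} {w} (alike s) ps = alike (same-suc graph i (neighbours-nbrs v) (neighbours-nbrs w) s
    (Pointwise.map⁺ to to (Pointwise.map same-vertices ps)))

  alike⇒degree : ∀ {i v w} → Alike (suc i) v w → length (nbrs v) ≡ length (nbrs w)
  alike⇒degree {i} {v} {w} (alike s) = trans (Eq.sym (degree v)) (trans (same⇒degree graph i s) (degree w))
    where
    degree : ∀ u → length (neighbours graph (to u)) ≡ length (nbrs u)
    degree u = trans (↭-length (neighbours-nbrs u)) (length-map to (nbrs u))

  alike⇒neighbour : ∀ {i v w x} → Alike (suc i) v w → x ∈ nbrs v → ∃[ y ] (y ∈ nbrs w × Alike i x y)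
  alike⇒neighbour {i} {v} {w} {x} (alike s) x∈ with same⇒neighbour graph i s
    (dec-true (from (to x) ∈? _)
      (Eq.subst₂ (λ y u → y ∈ nbrs u) (Eq.sym (strictlyInverseʳ x)) (Eq.sym (strictlyInverseʳ v)) x∈))
  ... | y , wy , xy = from y ,
    subst (λ u → from y ∈ nbrs u) (strictlyInverseʳ w) (does⇒ (from y ∈? _) wy) ,
    alike (subst (Same graph i (to x)) (Eq.sym (strictlyInverseˡ y)) xy)

-- Orders 10 to 13

module _ {n} (G : Graph n) where

  -- Equal partitions in rounds `j` and `suc j` give equal counts, hence equal refinements one round
  -- later.
  stable-suc : ∀ {j} → Stable G j → Stable G (suc j)
  stable-suc {j} st v w = cong₂ _∧_ (st v w)
    (allᵇ-cong (allFin n) λ u → cong₂ _≡ᵇ_ (counts v u) (counts w u))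
    where
    counts : ∀ v u → nbCount G j v u ≡ nbCount G (suc j) v u
    counts v u = length-filterᵇ-Pointwise (Pointwise-diag (allFin n) λ x → cong (adj G v x ∧_) (st x u))

  stable-mono : ∀ {i j} → i ≤ j → Stable G i → Stable G j
  stable-mono {i} {j} i≤j st with ℕ.m≤n⇒m<n∨m≡n i≤j
  ... | inj₂ refl = st
  stable-mono {i} {suc j} i≤j st | inj₁ (s≤s i≤j′) = stable-suc {j} (stable-mono i≤j′ st)

Matrix : Set → ℕ → Set
Matrix A n = Vec (Vec A n) n

module _ {n : ℕ} where

  matrix : ∀ {A : Set} → (Fin n → Fin n → A) → Matrix A n
  matrix f = Vec.tabulate λ v → Vec.tabulate (f v)

  _[_,_] : ∀ {A : Set} → Matrix A n → Fin n → Fin n → A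
  A [ v , w ] = lookup (lookup A v) w

  matrix-entry : ∀ {A : Set} (f : Fin n → Fin n → A) v w → matrix f [ v , w ] ≡ f v w
  matrix-entry f v w = trans (cong (λ row → lookup row w) (lookup∘tabulate _ v)) (lookup∘tabulate (f v) w)

  countMatrix : Matrix Bool n → Matrix Bool n → Matrix ℕ n
  countMatrix A S = matrix λ v u → length (filterᵇ (λ x → (A [ v , x ]) ∧ (S [ x , u ])) (allFin n))

  splitBy : Matrix ℕ n → Matrix Bool n → Matrix Bool n
  splitBy N S = matrix λ v w → (S [ v , w ]) ∧ allᵇ (λ u → (N [ v , u ]) ≡ᵇ (N [ w , u ])) (allFin n)

  refine : Matrix Bool n → Matrix Bool n → Matrix Bool n
  refine A S = splitBy (countMatrix A S) S

  -- Storing every round in a matrix keeps evaluation polynomial: unfolding sameColour itself recomputes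
  -- each round at every use.
  sameMatrix : Matrix Bool n → ℕ → Matrix Bool n
  sameMatrix A zero    = matrix λ _ _ → true
  sameMatrix A (suc i) = refine A (sameMatrix A i)

  sameMatrix-entry : ∀ (G : Graph n) i v w → sameMatrix (matrix (adj G)) i [ v , w ] ≡ sameColour G i v w
  sameMatrix-entry G zero    v w = matrix-entry _ v w
  sameMatrix-entry G (suc i) v w = trans (matrix-entry _ v w) (cong₂ _∧_ (sameMatrix-entry G i v w)
    (allᵇ-cong (allFin n) λ u → cong₂ _≡ᵇ_ (counts v u) (counts w u)))
    where
    counts : ∀ v u → countMatrix (matrix (adj G)) (sameMatrix (matrix (adj G)) i) [ v , u ] ≡ nbCount G i v u
    counts v u = trans (matrix-entry _ v u) (length-filterᵇ-Pointwise (Pointwise-diag (allFin n)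
      λ x → cong₂ _∧_ (matrix-entry (adj G) v x) (sameMatrix-entry G i x u)))

  -- Stability persists by `stable-mono`, so one split in round `suc j` refutes it for every earlier
  -- round.
  split⇒unstable : ∀ (G : Graph n) j v w → sameMatrix (matrix (adj G)) j [ v , w ] ≡ true →
    sameMatrix (matrix (adj G)) (suc j) [ v , w ] ≡ false → ∀ i → i < suc j → ¬ Stable G i
  split⇒unstable G j v w t f i i<1+j st =
    contradiction (trans (Eq.sym t) (trans (sameMatrix-entry G j v w)
      (trans (stable-mono G {i} {j} (ℕ.≤-pred i<1+j) st v w) (trans (Eq.sym (sameMatrix-entry G (suc j) v w)) f)))) λ ()

module _ (edges : List (ℕ × ℕ)) where

  joins : ℕ → ℕ → Bool
  joins u v = anyᵇ edges
    where
    anyᵇ : List (ℕ × ℕ) → Bool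
    anyᵇ []             = false
    anyᵇ ((x , y) ∷ es) = ((x ≡ᵇ u) ∧ (y ≡ᵇ v)) ∨ anyᵇ es

  -- Loops are masked and both orientations are tested, so every list of pairs describes a graph.
  edgeGraph : ∀ n → Graph n
  edgeGraph n = record
    { adj    = λ u v → not (toℕ u ≡ᵇ toℕ v) ∧ (joins (toℕ u) (toℕ v) ∨ joins (toℕ v) (toℕ u))
    ; sym    = λ u v → cong₂ (λ a b → not a ∧ b) (≡ᵇ-sym (toℕ u) (toℕ v)) (Bool.∨-comm (joins (toℕ u) _) _)
    ; irrefl = λ v → cong (λ b → not b ∧ (joins (toℕ v) (toℕ v) ∨ joins (toℕ v) (toℕ v))) (T⇒≡true (ℕ.≡⇒≡ᵇ (toℕ v) _ refl))
    }
    where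
    ≡ᵇ-sym : ∀ a b → (a ≡ᵇ b) ≡ (b ≡ᵇ a)
    ≡ᵇ-sym zero    zero    = refl
    ≡ᵇ-sym zero    (suc b) = refl
    ≡ᵇ-sym (suc a) zero    = refl
    ≡ᵇ-sym (suc a) (suc b) = ≡ᵇ-sym a b

record Attained (n : ℕ) : Set where
  constructor attained
  field proof : ∃[ k ] (IsWL1Max n k × (k ≡ n ∸ 2 ⊎ k ≡ n ∸ 1))

attained-by : ∀ {n} m → n ≡ 2 + m → (G : Graph n) → (∀ i → i < m → ¬ Stable G i) → Attained n
attained-by m refl G unst = attained (dichotomy m G unst)

edges₁₀ edges₁₂ : List (ℕ × ℕ)
edges₁₀ = (0 , 1) ∷ (0 , 2) ∷ (0 , 4) ∷ (0 , 5) ∷ (1 , 3) ∷ (1 , 8) ∷ (1 , 9) ∷ (2 , 3) ∷ (2 , 4)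
  ∷ (3 , 5) ∷ (4 , 6) ∷ (5 , 7) ∷ (6 , 7) ∷ (6 , 8) ∷ (7 , 9) ∷ (8 , 9) ∷ []
edges₁₂ = (0 , 2) ∷ (0 , 8) ∷ (0 , 9) ∷ (1 , 3) ∷ (1 , 10) ∷ (1 , 11) ∷ (2 , 4) ∷ (3 , 5) ∷ (4 , 5)
  ∷ (4 , 6) ∷ (5 , 7) ∷ (6 , 7) ∷ (6 , 8) ∷ (7 , 9) ∷ (8 , 10) ∷ (9 , 11) ∷ (10 , 11) ∷ []

-- For odd orders the last vertex is isolated.
attained₁₀ : Attained 10
-- Both `refl`s evaluate the stored matrices: vertices 6 and 7 share a colour in round 7 and no
-- longer in round 8.
attained₁₀ = attained-by 8 refl G (split⇒unstable G 7 (# 6) (# 7) refl refl)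
  where G = edgeGraph edges₁₀ 10

attained₁₁ : Attained 11
attained₁₁ = attained-by 9 refl G (split⇒unstable G 8 (# 8) (# 9) refl refl)
  where G = edgeGraph edges₁₀ 11

attained₁₂ : Attained 12
attained₁₂ = attained-by 10 refl G (split⇒unstable G 9 (# 8) (# 9) refl refl)
  where G = edgeGraph edges₁₂ 12

attained₁₃ : Attained 13
attained₁₃ = attained-by 11 refl G (split⇒unstable G 10 (# 10) (# 11) refl refl)
  where G = edgeGraph edges₁₂ 13

-- The long-refinement family

data Arm : Set where
  M L R : Arm

module Family (m r h : ℕ) (near : suc m ≡ r ⊎ m ≡ r ⊎ m ≡ suc r) where

  last : Arm → ℕ
  last M = m
  last L = r
  last R = r

  -- The bound is irrelevant, so that arm, index and side alone determine a node. Tops are separate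
  -- because their neighbourhoods differ in kind from those of nodes.
  data V : Set where
    node : ∀ a i .(i≤ : i ≤ last a) → Bool → V
    top  : Arm → Bool → V
    C    : Bool → V
    hub  : Fin h → V

  -- The top counts as index `suc (last a)`, which lets `nbrs` treat the edge upwards from a node
  -- uniformly.
  at : Arm → ℕ → Bool → V
  at a i b with i ≤? last a
  ... | yes i≤ = node a i i≤ b
  ... | no  _  = top a b

  data At (a : Arm) (b : Bool) : ℕ → V → Set where
    inner : ∀ {i} .(i≤ : i ≤ last a) → At a b i (node a i i≤ b)
    outer : At a b (suc (last a)) (top a b)

  at-view : ∀ a i b → i ≤ suc (last a) → At a b i (at a i b)
  at-view a i b i≤ with i ≤? last a
  ... | yes p = inner p
  ... | no ¬p with ℕ.≤-antisym i≤ (ℕ.≰⇒> ¬p)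
  ...   | refl = outer

  next-view : ∀ a i .(i≤ : i ≤ last a) b → At a b (suc i) (at a (suc i) b)
  next-view a i i≤ b = at-view a (suc i) b (s≤s (recompute (i ≤? last a) i≤))

  at-node : ∀ a i .(i≤ : i ≤ last a) b → at a i b ≡ node a i i≤ b
  at-node a i i≤ b with i ≤? last a
  ... | yes _ = refl
  ... | no ¬p = contradiction (recompute (i ≤? last a) i≤) ¬p

  at-top : ∀ a b → at a (suc (last a)) b ≡ top a b
  at-top a b with suc (last a) ≤? last a
  ... | yes p = contradiction p ℕ.1+n≰n
  ... | no  _ = refl

  -- The bottoms of `M` and `L` are matched with each other, where the path turns; the bottom of `R`
  -- ends the path and gets an inner edge instead. Either way the neighbour has depth 1, so the arms
  -- look alike at first.
  base : Arm → Bool → V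
  base M b = node L 0 z≤n b
  base L b = node M 0 z≤n b
  base R b = node R 0 z≤n (not b)

  hubs : List V
  hubs = map hub (allFin h)

  tops : Arm → Bool → List V
  tops M false = top L false ∷ top L true ∷ []
  tops M true  = top R false ∷ top R true ∷ []
  tops L b     = C b ∷ top M false ∷ []
  tops R b     = C b ∷ top M true ∷ []

  -- A bottom has degree `2 + h`, a hub degree 6 and every other vertex degree 3. The order of the
  -- lists matters: later proofs match neighbours entry by entry.
  nbrs : V → List V
  nbrs (node a zero i≤ b)    = base a b ∷ at a 1 b ∷ hubs
  nbrs (node a (suc i) i≤ b) =
    node a i (ℕ.<⇒≤ i≤) b ∷ at a (2 + i) b ∷ node a (suc i) i≤ (not b) ∷ []
  nbrs (top a b) = node a (last a) ℕ.≤-refl b ∷ tops a b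
  nbrs (C b)     = top L b ∷ top R b ∷ C (not b) ∷ []
  nbrs (hub k)   = node M 0 z≤n false ∷ node M 0 z≤n true ∷ node L 0 z≤n false ∷ node L 0 z≤n true
    ∷ node R 0 z≤n false ∷ node R 0 z≤n true ∷ []

  b≢not-b : ∀ {b} → b ≢ not b
  b≢not-b {false} ()
  b≢not-b {true} ()

  ∈-above : ∀ a i .(i≤ : i ≤ last a) b → at a (suc i) b ∈ nbrs (node a i i≤ b)
  ∈-above a zero    i≤ b = there (here refl)
  ∈-above a (suc i) i≤ b = there (here refl)

  next-∋ : ∀ a i .(i≤ : i ≤ last a) b → node a i i≤ b ∈ nbrs (at a (suc i) b)
  next-∋ a i i≤ b with at a (suc i) b | next-view a i i≤ b
  ... | _ | inner _ = here refl
  ... | _ | outer   = here refl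

  nbrs-sym : ∀ v {x} → x ∈ nbrs v → v ∈ nbrs x
  nbrs-sym (node M zero i≤ b) (here refl) = here refl
  nbrs-sym (node L zero i≤ b) (here refl) = here refl
  nbrs-sym (node R zero i≤ false) (here refl) = here refl
  nbrs-sym (node R zero i≤ true) (here refl) = here refl
  nbrs-sym (node a zero i≤ b) (there (here refl)) = next-∋ a zero i≤ b
  nbrs-sym (node a zero i≤ b) (there (there x∈)) with ∈-map⁻ hub x∈
  nbrs-sym (node M zero i≤ false) (there (there x∈)) | k , _ , refl = here refl
  nbrs-sym (node M zero i≤ true)  (there (there x∈)) | k , _ , refl = there (here refl)
  nbrs-sym (node L zero i≤ false) (there (there x∈)) | k , _ , refl = there (there (here refl))
  nbrs-sym (node L zero i≤ true)  (there (there x∈)) | k , _ , refl = there (there (there (here refl)))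
  nbrs-sym (node R zero i≤ false) (there (there x∈)) | k , _ , refl =
    there (there (there (there (here refl))))
  nbrs-sym (node R zero i≤ true)  (there (there x∈)) | k , _ , refl =
    there (there (there (there (there (here refl)))))
  nbrs-sym (node a (suc i) i≤ b) (here refl) = subst (_∈ nbrs (node a i _ b))
    (at-node a (suc i) i≤ b) (∈-above a i (ℕ.<⇒≤ i≤) b)
  nbrs-sym (node a (suc i) i≤ b) (there (here refl)) = next-∋ a (suc i) i≤ b
  nbrs-sym (node a (suc i) i≤ false) (there (there (here refl))) = there (there (here refl))
  nbrs-sym (node a (suc i) i≤ true) (there (there (here refl))) = there (there (here refl))
  nbrs-sym (top a b) (here refl) = subst (_∈ nbrs (node a (last a) _ b))
    (at-top a b) (∈-above a (last a) ℕ.≤-refl b)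
  nbrs-sym (top M false) (there (here refl)) = there (there (here refl))
  nbrs-sym (top M false) (there (there (here refl))) = there (there (here refl))
  nbrs-sym (top M true) (there (here refl)) = there (there (here refl))
  nbrs-sym (top M true) (there (there (here refl))) = there (there (here refl))
  nbrs-sym (top L b) (there (here refl)) = here refl
  nbrs-sym (top L false) (there (there (here refl))) = there (here refl)
  nbrs-sym (top L true) (there (there (here refl))) = there (there (here refl))
  nbrs-sym (top R b) (there (here refl)) = there (here refl)
  nbrs-sym (top R false) (there (there (here refl))) = there (here refl)
  nbrs-sym (top R true) (there (there (here refl))) = there (there (here refl))
  nbrs-sym (C b) (here refl) = there (here refl)
  nbrs-sym (C b) (there (here refl)) = there (here refl)
  nbrs-sym (C false) (there (there (here refl))) = there (there (here refl))
  nbrs-sym (C true) (there (there (here refl))) = there (there (here refl))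
  nbrs-sym (hub k) (here refl) = there (there (∈-map⁺ hub (∈-allFin k)))
  nbrs-sym (hub k) (there (here refl)) = there (there (∈-map⁺ hub (∈-allFin k)))
  nbrs-sym (hub k) (there (there (here refl))) = there (there (∈-map⁺ hub (∈-allFin k)))
  nbrs-sym (hub k) (there (there (there (here refl)))) = there (there (∈-map⁺ hub (∈-allFin k)))
  nbrs-sym (hub k) (there (there (there (there (here refl))))) =
    there (there (∈-map⁺ hub (∈-allFin k)))
  nbrs-sym (hub k) (there (there (there (there (there (here refl)))))) =
    there (there (∈-map⁺ hub (∈-allFin k)))

  node-injectiveⁱ : ∀ {a b a′ b′ i j} .{i≤ : i ≤ last a} .{j≤ : j ≤ last a′} →
    node a i i≤ b ≡ node a′ j j≤ b′ → i ≡ j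
  node-injectiveⁱ refl = refl

  node-injectiveᵇ : ∀ {a b a′ b′ i j} .{i≤ : i ≤ last a} .{j≤ : j ≤ last a′} →
    node a i i≤ b ≡ node a′ j j≤ b′ → b ≡ b′
  node-injectiveᵇ refl = refl

  at-fresh : ∀ {a i b x} → (∀ .(i≤ : i ≤ last a) → x ≢ node a i i≤ b) → x ≢ top a b → x ≢ at a i b
  at-fresh {a} {i} n t with i ≤? last a
  ... | yes i≤ = n i≤
  ... | no  _  = t

  base≢at : ∀ a b → base a b ≢ at a 1 b
  base≢at M b = at-fresh {M} {1} (λ _ ()) λ ()
  base≢at L b = at-fresh {L} {1} (λ _ ()) λ ()
  base≢at R b = at-fresh {R} {1} (λ _ ()) λ ()

  base≢hub : ∀ a b k → base a b ≢ hub k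
  base≢hub M b k ()
  base≢hub L b k ()
  base≢hub R b k ()

  nbrs-unique : ∀ v → Unique (nbrs v)
  nbrs-unique (node a zero i≤ b) =
    (base≢at a b ∷ All.map⁺ (All.tabulate⁺ (base≢hub a b)))
    ∷ All.map⁺ (All.tabulate⁺ λ k e → at-fresh {a} {1} (λ _ ()) (λ ()) (Eq.sym e))
    ∷ Unique.map⁺ (λ { refl → refl }) (Unique.allFin⁺ h)
  nbrs-unique (node a (suc i) i≤ b) =
    (at-fresh {a} {2 + i} (λ _ e → contradiction (node-injectiveⁱ e) λ ()) (λ ())
      ∷ (λ e → contradiction (node-injectiveⁱ e) λ ()) ∷ [])
    ∷ ((λ e → at-fresh {a} {2 + i} (λ _ e′ → contradiction (node-injectiveⁱ e′) λ ()) (λ ()) (Eq.sym e)) ∷ [])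
    ∷ [] ∷ []
  nbrs-unique (top M false) = ((λ ()) ∷ (λ ()) ∷ []) ∷ ((λ ()) ∷ []) ∷ [] ∷ []
  nbrs-unique (top M true)  = ((λ ()) ∷ (λ ()) ∷ []) ∷ ((λ ()) ∷ []) ∷ [] ∷ []
  nbrs-unique (top L b) = ((λ ()) ∷ (λ ()) ∷ []) ∷ ((λ ()) ∷ []) ∷ [] ∷ []
  nbrs-unique (top R b) = ((λ ()) ∷ (λ ()) ∷ []) ∷ ((λ ()) ∷ []) ∷ [] ∷ []
  nbrs-unique (C b)     = ((λ ()) ∷ (λ ()) ∷ []) ∷ ((λ ()) ∷ []) ∷ [] ∷ []
  nbrs-unique (hub k) =
    ((λ ()) ∷ (λ ()) ∷ (λ ()) ∷ (λ ()) ∷ (λ ()) ∷ [])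
    ∷ ((λ ()) ∷ (λ ()) ∷ (λ ()) ∷ (λ ()) ∷ [])
    ∷ ((λ ()) ∷ (λ ()) ∷ (λ ()) ∷ [])
    ∷ ((λ ()) ∷ (λ ()) ∷ []) ∷ ((λ ()) ∷ []) ∷ [] ∷ []

  nbrs-irrefl : ∀ v → v ∉ nbrs v
  nbrs-irrefl (node R zero i≤ b) (here e) = b≢not-b (node-injectiveᵇ e)
  nbrs-irrefl (node a zero i≤ b) (there (here e)) = at-fresh {a} {1} (λ _ ()) (λ ()) e
  nbrs-irrefl (node a zero i≤ b) (there (there v∈)) with ∈-map⁻ hub v∈
  ... | _ , _ , ()
  nbrs-irrefl (node a (suc i) i≤ b) (here e) = contradiction (node-injectiveⁱ e) ℕ.1+n≢n
  nbrs-irrefl (node a (suc i) i≤ b) (there (here e)) =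
    at-fresh {a} {2 + i} (λ _ e′ → contradiction (node-injectiveⁱ e′) λ ()) (λ ()) e
  nbrs-irrefl (node a (suc i) i≤ b) (there (there (here e))) = b≢not-b (node-injectiveᵇ e)
  nbrs-irrefl (top M false) (there (here ()))
  nbrs-irrefl (top M true)  (there (here ()))
  nbrs-irrefl (top M false) (there (there (here ())))
  nbrs-irrefl (top M true)  (there (there (here ())))
  nbrs-irrefl (top L b) (there (there (here ())))
  nbrs-irrefl (top R b) (there (there (here ())))
  nbrs-irrefl (C false) (there (there (here ())))
  nbrs-irrefl (C true)  (there (there (here ())))
  nbrs-irrefl (hub k) (there (there (there (there (there (there ()))))))

  -- Numbering of the vertices

  order : ℕ
  order = (suc m + (suc r + (suc r + 4))) * 2 + h

  Code : Set
  Code = ((Fin (suc m) ⊎ (Fin (suc r) ⊎ (Fin (suc r) ⊎ Fin 4))) × Bool) ⊎ Fin h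

  encode : V → Code
  encode (node M i i≤ b) = inj₁ (inj₁ (fromℕ< (s≤s i≤)) , b)
  encode (node L i i≤ b) = inj₁ (inj₂ (inj₁ (fromℕ< (s≤s i≤))) , b)
  encode (node R i i≤ b) = inj₁ (inj₂ (inj₂ (inj₁ (fromℕ< (s≤s i≤)))) , b)
  encode (top M b)       = inj₁ (inj₂ (inj₂ (inj₂ 0F)) , b)
  encode (top L b)       = inj₁ (inj₂ (inj₂ (inj₂ 1F)) , b)
  encode (top R b)       = inj₁ (inj₂ (inj₂ (inj₂ 2F)) , b)
  encode (C b)           = inj₁ (inj₂ (inj₂ (inj₂ 3F)) , b)
  encode (hub k)         = inj₂ k

  decode : Code → V
  decode (inj₁ (inj₁ i , b))               = node M (toℕ i) (Fin.toℕ≤pred[n] i) b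
  decode (inj₁ (inj₂ (inj₁ i) , b))        = node L (toℕ i) (Fin.toℕ≤pred[n] i) b
  decode (inj₁ (inj₂ (inj₂ (inj₁ i)) , b)) = node R (toℕ i) (Fin.toℕ≤pred[n] i) b
  decode (inj₁ (inj₂ (inj₂ (inj₂ 0F)) , b)) = top M b
  decode (inj₁ (inj₂ (inj₂ (inj₂ 1F)) , b)) = top L b
  decode (inj₁ (inj₂ (inj₂ (inj₂ 2F)) , b)) = top R b
  decode (inj₁ (inj₂ (inj₂ (inj₂ 3F)) , b)) = C b
  decode (inj₂ k)                           = hub k

  node-cong : ∀ a {i j} b .(i≤ : i ≤ last a) .(j≤ : j ≤ last a) → i ≡ j → node a i i≤ b ≡ node a j j≤ b
  node-cong a b i≤ j≤ refl = refl

  decode-encode : ∀ v → decode (encode v) ≡ v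
  decode-encode (node M i i≤ b) = node-cong M b _ _ (Fin.toℕ-fromℕ< (s≤s i≤))
  decode-encode (node L i i≤ b) = node-cong L b _ _ (Fin.toℕ-fromℕ< (s≤s i≤))
  decode-encode (node R i i≤ b) = node-cong R b _ _ (Fin.toℕ-fromℕ< (s≤s i≤))
  decode-encode (top M b) = refl
  decode-encode (top L b) = refl
  decode-encode (top R b) = refl
  decode-encode (C b)     = refl
  decode-encode (hub k)   = refl

  encode-decode : ∀ c → encode (decode c) ≡ c
  encode-decode (inj₁ (inj₁ i , b)) = cong (λ i → inj₁ (inj₁ i , b)) (Fin.fromℕ<-toℕ i _)
  encode-decode (inj₁ (inj₂ (inj₁ i) , b)) =
    cong (λ i → inj₁ (inj₂ (inj₁ i) , b)) (Fin.fromℕ<-toℕ i _)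
  encode-decode (inj₁ (inj₂ (inj₂ (inj₁ i)) , b)) =
    cong (λ i → inj₁ (inj₂ (inj₂ (inj₁ i)) , b)) (Fin.fromℕ<-toℕ i _)
  encode-decode (inj₁ (inj₂ (inj₂ (inj₂ 0F)) , b)) = refl
  encode-decode (inj₁ (inj₂ (inj₂ (inj₂ 1F)) , b)) = refl
  encode-decode (inj₁ (inj₂ (inj₂ (inj₂ 2F)) , b)) = refl
  encode-decode (inj₁ (inj₂ (inj₂ (inj₂ 3F)) , b)) = refl
  encode-decode (inj₂ k) = refl

  V↔Fin : V ↔ Fin order
  V↔Fin = Code↔Fin ↔-∘ mk↔ₛ′ encode decode encode-decode decode-encode
    where
    _⊎-Fin_ : ∀ {A B : Set} {k l} → A ↔ Fin k → B ↔ Fin l → (A ⊎ B) ↔ Fin (k + l)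
    f ⊎-Fin g = ↔-sym Fin.+↔⊎ ↔-∘ (f ⊎-↔ g)
    Code↔Fin : Code ↔ Fin order
    Code↔Fin = (↔-sym Fin.*↔× ↔-∘
        ((↔-id _ ⊎-Fin (↔-id _ ⊎-Fin (↔-id _ ⊎-Fin ↔-id _))) ×-↔ ↔-sym Fin.2↔Bool))
      ⊎-Fin ↔-id _

  -- Depths and the first phase of the refinement

  twin : V → V
  twin (node a i i≤ b) = node a i i≤ (not b)
  twin (top a b)       = top a (not b)
  twin (C b)           = C (not b)
  twin (hub k)         = hub k

  twin-at : ∀ a i b → at a i (not b) ≡ twin (at a i b)
  twin-at a i b with i ≤? last a
  ... | yes _ = refl
  ... | no  _ = refl

  twin-base : ∀ a b → base a (not b) ≡ twin (base a b)
  twin-base M b = refl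
  twin-base L b = refl
  twin-base R b = refl

  -- Depth 0 is kept for hubs, so bottoms have depth 1. The pair `C` is one level above the tops of
  -- `L` and `R`.
  depth : V → ℕ
  depth (node a i i≤ b) = suc i
  depth (top a b)       = 2 + last a
  depth (C b)           = 3 + r
  depth (hub k)         = 0

  depth-at : ∀ a i .(i≤ : i ≤ last a) b → depth (at a (suc i) b) ≡ 2 + i
  depth-at a i i≤ b with at a (suc i) b | next-view a i i≤ b
  ... | _ | inner _ = refl
  ... | _ | outer   = refl

  depth-base : ∀ a b → depth (base a b) ≡ 1
  depth-base M b = refl
  depth-base L b = refl
  depth-base R b = refl

  nodeDepths : ℕ → List ℕ
  nodeDepths zero    = 1 ∷ 2 ∷ tabulate {n = h} λ _ → 0
  nodeDepths (suc i) = 1 + i ∷ 3 + i ∷ 2 + i ∷ []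

  topDepths : Arm → List ℕ
  topDepths M = 1 + m ∷ 2 + r ∷ 2 + r ∷ []
  topDepths L = 1 + r ∷ 3 + r ∷ 2 + m ∷ []
  topDepths R = 1 + r ∷ 3 + r ∷ 2 + m ∷ []

  depths : V → List ℕ
  depths (node a i i≤ b) = nodeDepths i
  depths (top a b)       = topDepths a
  depths (C b)           = 2 + r ∷ 2 + r ∷ 3 + r ∷ []
  depths (hub k)         = 1 ∷ 1 ∷ 1 ∷ 1 ∷ 1 ∷ 1 ∷ []

  map-depth-nbrs : ∀ v → map depth (nbrs v) ≡ depths v
  map-depth-nbrs (node a zero i≤ b) = cong₂ _∷_ (depth-base a b) (cong₂ _∷_ (depth-at a 0 i≤ b)
    (trans (cong (map depth) (map-tabulate (λ k → k) hub)) (map-tabulate hub depth)))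
  map-depth-nbrs (node a (suc i) i≤ b) = cong (λ d → 1 + i ∷ d ∷ 2 + i ∷ []) (depth-at a (suc i) i≤ b)
  map-depth-nbrs (top M false) = refl
  map-depth-nbrs (top M true)  = refl
  map-depth-nbrs (top L b)     = refl
  map-depth-nbrs (top R b)     = refl
  map-depth-nbrs (C b)         = refl
  map-depth-nbrs (hub k)       = refl

  m≤1+r : m ≤ suc r
  m≤1+r = case near
    where
    case : suc m ≡ r ⊎ m ≡ r ⊎ m ≡ suc r → m ≤ suc r
    case (inj₁ refl)        = ℕ.m≤n+m m 2
    case (inj₂ (inj₁ refl)) = ℕ.n≤1+n m
    case (inj₂ (inj₂ refl)) = ℕ.≤-refl

  r≤1+m : r ≤ suc m
  r≤1+m = case near
    where
    case : suc m ≡ r ⊎ m ≡ r ⊎ m ≡ suc r → r ≤ suc m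
    case (inj₁ refl)        = ℕ.≤-refl
    case (inj₂ (inj₁ refl)) = ℕ.n≤1+n m
    case (inj₂ (inj₂ refl)) = ℕ.m≤n+m r 2

  -- For the edges between the start of the path and the tops of `L` and `R` this is where `near`
  -- enters, as `m≤1+r` and `r≤1+m`.
  depths-≥ : ∀ v → All (λ d → depth v ≤ suc d) (depths v)
  depths-≥ (node a zero i≤ b) = s≤s z≤n ∷ s≤s z≤n ∷ All.tabulate⁺ λ _ → s≤s z≤n
  depths-≥ (node a (suc i) i≤ b) = ℕ.≤-refl ∷ ℕ.m≤n+m _ 2 ∷ ℕ.n≤1+n _ ∷ []
  depths-≥ (top M b) = ℕ.≤-refl ∷ s≤s (s≤s m≤1+r) ∷ s≤s (s≤s m≤1+r) ∷ []
  depths-≥ (top L b) = ℕ.≤-refl ∷ ℕ.m≤n+m _ 2 ∷ s≤s (s≤s r≤1+m) ∷ []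
  depths-≥ (top R b) = ℕ.≤-refl ∷ ℕ.m≤n+m _ 2 ∷ s≤s (s≤s r≤1+m) ∷ []
  depths-≥ (C b) = ℕ.≤-refl ∷ ℕ.≤-refl ∷ ℕ.n≤1+n _ ∷ []
  depths-≥ (hub k) = z≤n ∷ z≤n ∷ z≤n ∷ z≤n ∷ z≤n ∷ z≤n ∷ []

  -- Equality of min t d and min t d′.
  Trunc : ℕ → ℕ → ℕ → Set
  Trunc t d d′ = d ≡ d′ ⊎ (t ≤ d × t ≤ d′)

  trunc-sym : ∀ {t d d′} → Trunc t d d′ → Trunc t d′ d
  trunc-sym (inj₁ e)       = inj₁ (Eq.sym e)
  trunc-sym (inj₂ (p , q)) = inj₂ (q , p)

  trunc-refl* : ∀ {t} ds → Pointwise (Trunc t) ds ds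
  trunc-refl* ds = Pointwise-diag ds λ _ → inj₁ refl

  trunc-≥* : ∀ {t ds ds′} → All (t ≤_) ds → All (t ≤_) ds′ → length ds ≡ length ds′ →
    Pointwise (Trunc t) ds ds′
  trunc-≥* []       []       refl = []
  trunc-≥* (p ∷ ps) (q ∷ qs) e    = inj₂ (p , q) ∷ trunc-≥* ps qs (ℕ.suc-injective e)

  length-depths : ∀ v → 2 ≤ depth v ⊎ (1 ≤ depth v × h ≡ 1) → length (depths v) ≡ 3
  length-depths (node a zero i≤ b) (inj₁ (s≤s ()))
  length-depths (node a zero i≤ b) (inj₂ (_ , refl)) = refl
  length-depths (node a (suc i) i≤ b) _ = refl
  length-depths (top M b) _ = refl
  length-depths (top L b) _ = refl
  length-depths (top R b) _ = refl
  length-depths (C b) _ = refl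
  length-depths (hub k) (inj₁ ())
  length-depths (hub k) (inj₂ (() , _))

  Folded : ℕ → V → V → Set
  Folded t v w = Trunc t (depth v) (depth w)

  Folded-nbrs : ∀ {t} v w → Pointwise (Trunc t) (depths v) (depths w) →
    Pointwise (Folded t) (nbrs v) (nbrs w)
  Folded-nbrs v w p = Pointwise.map⁻ depth depth
    (Eq.subst₂ (Pointwise (Trunc _)) (Eq.sym (map-depth-nbrs v)) (Eq.sym (map-depth-nbrs w)) p)

  -- The tops of M see different depths than nodes of the same depth do; truncation hides this as long as
  -- the tops of L are not yet told apart from what lies below them.
  shallow-depths : ∀ {t} v w → t ≤ suc r → depth v ≡ depth w → depth v ≤ t →
    Pointwise (Trunc t) (depths v) (depths w)
  shallow-depths (hub _) (hub _) _ _ _ = trunc-refl* _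
  shallow-depths (node a i i≤ b) (node a′ .i i≤′ b′) _ refl _ = trunc-refl* _
  shallow-depths (node a (suc i) i≤ b) (top M b′) t≤ refl d≤ =
    inj₁ refl ∷ inj₂ (ℕ.≤-trans t≤ (ℕ.≤-trans (s≤s r≤1+m) (ℕ.n≤1+n _)) , ℕ.≤-trans t≤ (ℕ.n≤1+n _))
    ∷ inj₂ (ℕ.≤-trans t≤ (s≤s r≤1+m) , ℕ.≤-trans t≤ (ℕ.n≤1+n _)) ∷ []
  shallow-depths (top M b) (node a (suc i) i≤ b′) t≤ refl d≤ =
    inj₁ refl ∷ inj₂ (ℕ.≤-trans t≤ (ℕ.n≤1+n _) , ℕ.≤-trans t≤ (ℕ.≤-trans (s≤s r≤1+m) (ℕ.n≤1+n _)))
    ∷ inj₂ (ℕ.≤-trans t≤ (ℕ.n≤1+n _) , ℕ.≤-trans t≤ (s≤s r≤1+m)) ∷ []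
  shallow-depths (top M b) (top M b′) _ _ _ = trunc-refl* _
  shallow-depths (top L b) _ t≤ _ d≤ = ⊥-elim (ℕ.1+n≰n (ℕ.≤-trans d≤ t≤))
  shallow-depths (top R b) _ t≤ _ d≤ = ⊥-elim (ℕ.1+n≰n (ℕ.≤-trans d≤ t≤))
  shallow-depths (C b)     _ t≤ _ d≤ = ⊥-elim (ℕ.1+n≰n (ℕ.≤-trans (ℕ.n≤1+n _) (ℕ.≤-trans d≤ t≤)))
  shallow-depths v (top L b) t≤ e d≤ = ⊥-elim (ℕ.1+n≰n (ℕ.≤-trans (subst (_≤ _) e d≤) t≤))
  shallow-depths v (top R b) t≤ e d≤ = ⊥-elim (ℕ.1+n≰n (ℕ.≤-trans (subst (_≤ _) e d≤) t≤))
  shallow-depths v (C b)     t≤ e d≤ =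
    ⊥-elim (ℕ.1+n≰n (ℕ.≤-trans (ℕ.n≤1+n _) (ℕ.≤-trans (subst (_≤ _) e d≤) t≤)))

  -- If both depths exceed `t`, there are three neighbours on each side, all of depth at least `t`;
  -- the third hypothesis excludes bottoms of degree 2 here. Otherwise the depths are equal and at
  -- most `t`, and `shallow-depths` applies.
  Folded-suc : ∀ t v w → t ≤ suc r → 1 ≤ t ⊎ h ≡ 1 → Folded (suc t) v w →
    Pointwise (Folded t) (nbrs v) (nbrs w)
  Folded-suc t v w t≤ pos f = Folded-nbrs v w (case f)
    where
    deep : t < depth v → t < depth w → Pointwise (Trunc t) (depths v) (depths w)
    deep p q = trunc-≥* (All.map (λ d → ℕ.≤-pred (ℕ.≤-trans p d)) (depths-≥ v))
      (All.map (λ d → ℕ.≤-pred (ℕ.≤-trans q d)) (depths-≥ w))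
      (trans (length-depths v (three v p)) (Eq.sym (length-depths w (three w q))))
      where
      three : ∀ u → t < depth u → 2 ≤ depth u ⊎ (1 ≤ depth u × h ≡ 1)
      three u t<d = Sum.map (λ 1≤t → ℕ.≤-trans (s≤s 1≤t) t<d) (ℕ.≤-trans (s≤s z≤n) t<d ,_) pos
    case : Folded (suc t) v w → Pointwise (Trunc t) (depths v) (depths w)
    case (inj₂ (p , q)) = deep p q
    case (inj₁ e) with ℕ.≤-<-connex (depth v) t
    ... | inj₁ d≤t = shallow-depths v w t≤ e d≤t
    ... | inj₂ t<d = deep t<d (subst (t <_) e t<d)

  Folded-pred : ∀ {t v w} → Folded (suc t) v w → Folded t v w
  Folded-pred (inj₁ e)       = inj₁ e
  Folded-pred (inj₂ (p , q)) = inj₂ (ℕ.<⇒≤ p , ℕ.<⇒≤ q)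

  -- Positions on the path and the two waves

  data Twin (v : V) : V → Set where
    itself : Twin v v
    other  : Twin v (twin v)

  twin-twin : ∀ v → twin (twin v) ≡ v
  twin-twin (node a i i≤ b) = cong (node a i i≤) (Bool.not-involutive b)
  twin-twin (top a b)       = cong (top a) (Bool.not-involutive b)
  twin-twin (C b)           = cong C (Bool.not-involutive b)
  twin-twin (hub k)         = refl

  Twin-sym : ∀ {v w} → Twin v w → Twin w v
  Twin-sym     itself = itself
  Twin-sym {v} other  = subst (Twin (twin v)) (twin-twin v) other

  Twin-other : ∀ {v w} → w ≡ twin v → Twin v w
  Twin-other refl = other

  depth-twin : ∀ {v w} → Twin v w → depth v ≡ depth w
  depth-twin itself = refl
  depth-twin {node a i i≤ b} other = refl
  depth-twin {top a b}       other = refl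
  depth-twin {C b}           other = refl
  depth-twin {hub k}         other = refl

  depths-twin : ∀ v → depths v ≡ depths (twin v)
  depths-twin (node a i i≤ b) = refl
  depths-twin (top a b)       = refl
  depths-twin (C b)           = refl
  depths-twin (hub k)         = refl

  -- The position of the pair `node L r`, the last one before the tops of `L`.
  o : ℕ
  o = r + (2 + m)

  -- The path is cut into segments whose values fill disjoint intervals: `lo` up to `suc m`, `mid`
  -- from `2 + m` to `o`, `hi` beyond `o`. Injectivity of positions can then be shown segment by
  -- segment.
  data Place : Set where
    lo mid hi : ℕ → Place

  place : V → Place
  place (node M i i≤ b) = lo (suc (m ∸ i))
  place (node L i i≤ b) = mid i
  place (node R i i≤ b) = hi (4 + (r ∸ i))
  place (top M b)       = lo 0
  place (top L b)       = hi 1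
  place (C b)           = hi 2
  place (top R b)       = hi 3
  place (hub k)         = hi (5 + r)

  value : Place → ℕ
  value (lo k)  = k
  value (mid k) = k + (2 + m)
  value (hi k)  = k + o

  -- The position on the path top M, M m, …, M 0, L 0, …, L r, top L, C, top R, R r, …, R 0 of pairs;
  -- hubs are placed behind its end.
  pos : V → ℕ
  pos v = value (place v)

  pos-twin : ∀ {v w} → Twin v w → pos v ≡ pos w
  pos-twin itself = refl
  pos-twin {node M i i≤ b} other = refl
  pos-twin {node L i i≤ b} other = refl
  pos-twin {node R i i≤ b} other = refl
  pos-twin {top M b}       other = refl
  pos-twin {top L b}       other = refl
  pos-twin {top R b}       other = refl
  pos-twin {C b}           other = refl
  pos-twin {hub k}         other = refl

  ∸-step : ∀ n i → n ∸ i ≤ suc (n ∸ suc i)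
  ∸-step zero    zero    = z≤n
  ∸-step zero    (suc i) = z≤n
  ∸-step (suc n) zero    = ℕ.≤-refl
  ∸-step (suc n) (suc i) = ∸-step n i

  pos-at : ∀ a i .(i≤ : i ≤ last a) b → pos (node a i i≤ b) ≤ suc (pos (at a (suc i) b))
  pos-at a i i≤ b with at a (suc i) b | next-view a i i≤ b
  pos-at M i i≤ b | _ | inner _ = s≤s (∸-step m i)
  pos-at L i i≤ b | _ | inner _ = ℕ.m≤n+m _ 2
  pos-at R i i≤ b | _ | inner _ = ℕ.+-monoˡ-≤ o (s≤s (s≤s (s≤s (s≤s (∸-step r i)))))
  pos-at M i i≤ b | _ | outer   = ℕ.≤-reflexive (cong suc (ℕ.n∸n≡0 m))
  pos-at L i i≤ b | _ | outer   = ℕ.m≤n+m _ 2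
  pos-at R i i≤ b | _ | outer   = ℕ.≤-reflexive (cong (λ k → 4 + k + o) (ℕ.n∸n≡0 r))

  pos-hub : ∀ a i .(i≤ : i ≤ last a) b → pos (node a i i≤ b) ≤ 5 + r + o
  pos-hub M i i≤ b = ℕ.≤-trans (s≤s (ℕ.≤-trans (ℕ.m∸n≤m m i) (ℕ.n≤1+n m)))
    (ℕ.≤-trans (ℕ.m≤n+m (2 + m) r) (ℕ.m≤n+m o (5 + r)))
  pos-hub L i i≤ b = ℕ.≤-trans (ℕ.+-monoˡ-≤ (2 + m) (recompute (i ≤? r) i≤)) (ℕ.m≤n+m o (5 + r))
  pos-hub R i i≤ b = ℕ.+-monoˡ-≤ o (ℕ.+-mono-≤ {4} {5} (ℕ.n≤1+n 4) (ℕ.m∸n≤m r i))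

  pos-base : ∀ a b → pos (node a 0 z≤n b) ≤ suc (pos (base a b))
  pos-base M b = s≤s (ℕ.m≤n+m m 2)
  pos-base L b = ℕ.≤-refl
  pos-base R b = ℕ.n≤1+n _

  pos-below : ∀ a i .(i≤ : suc i ≤ last a) b →
    pos (node a (suc i) i≤ b) ≤ suc (pos (node a i (ℕ.<⇒≤ i≤) b))
  pos-below M i i≤ b = s≤s (ℕ.≤-trans (ℕ.∸-monoʳ-≤ m (ℕ.n≤1+n i)) (ℕ.n≤1+n _))
  pos-below L i i≤ b = ℕ.≤-refl
  pos-below R i i≤ b = ℕ.≤-trans (ℕ.+-monoˡ-≤ o (ℕ.+-monoʳ-≤ 4 (ℕ.∸-monoʳ-≤ r (ℕ.n≤1+n i)))) (ℕ.n≤1+n _)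

  pos-flip : ∀ a i .(i≤ : i ≤ last a) b → pos (node a i i≤ b) ≤ suc (pos (node a i i≤ (not b)))
  pos-flip a i i≤ b = ℕ.≤-trans (ℕ.≤-reflexive (pos-twin {node a i i≤ b} other)) (ℕ.n≤1+n _)

  -- Through a node a wave advances by at most one position per round. Hubs lie behind the end of
  -- the path, so they offer no shortcut.
  pos-node : ∀ a i .(i≤ : i ≤ last a) b →
    All (λ x → pos (node a i i≤ b) ≤ suc (pos x)) (nbrs (node a i i≤ b))
  pos-node a zero i≤ b = pos-base a b ∷ pos-at a 0 i≤ b
    ∷ All.map⁺ (All.tabulate⁺ λ k → ℕ.≤-trans (pos-hub a 0 i≤ b) (ℕ.n≤1+n _))
  pos-node a (suc i) i≤ b = pos-below a i i≤ b ∷ pos-at a (suc i) i≤ b ∷ pos-flip a (suc i) i≤ b ∷ []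

  -- What the first wave must leave together when it has reached position `s`: behind it only twins,
  -- ahead of it depth still decides.
  data Unfolded (s : ℕ) (v w : V) : Set where
    twins  : Twin v w → Unfolded s v w
    folded : depth v ≡ depth w → s ≤ pos v → s ≤ pos w → Unfolded s v w

  Unfolded-refl* : ∀ {s} vs → Pointwise (Unfolded s) vs vs
  Unfolded-refl* vs = Pointwise-diag vs λ _ → twins itself

  folded* : ∀ {s vs ws} → map depth vs ≡ map depth ws → All (λ v → s ≤ pos v) vs →
    All (λ w → s ≤ pos w) ws → Pointwise (Unfolded s) vs ws
  folded* {vs = []}    {[]}    _ []       []       = []
  folded* {vs = _ ∷ _} {_ ∷ _} e (p ∷ ps) (q ∷ qs) =
    folded (∷-injectiveˡ e) p q ∷ folded* (∷-injectiveʳ e) ps qs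

  node≤ : ∀ a i .(i≤ : i ≤ last a) → i ≤ suc r
  node≤ M i i≤ = ℕ.≤-trans (recompute (i ≤? m) i≤) m≤1+r
  node≤ L i i≤ = ℕ.≤-trans (recompute (i ≤? r) i≤) (ℕ.n≤1+n r)
  node≤ R i i≤ = ℕ.≤-trans (recompute (i ≤? r) i≤) (ℕ.n≤1+n r)

  twin-nbrs : ∀ {s} v → s ≤ suc o → Pointwise (Unfolded s) (nbrs v) (nbrs (twin v))
  twin-nbrs (node a zero i≤ b) s≤ =
    twins (Twin-other (twin-base a b)) ∷ twins (Twin-other (twin-at a 1 b)) ∷ Unfolded-refl* hubs
  twin-nbrs (node a (suc i) i≤ b) s≤ = twins other ∷ twins (Twin-other (twin-at a (2 + i) b)) ∷ twins other ∷ []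
  -- The twins at the start see the tops of `L` and of `R` respectively. Both lie ahead of the wave
  -- while `s ≤ suc o`, so equal depth keeps them together.
  twin-nbrs (top M false) s≤ = twins other ∷ folded refl s≤ s≤′ ∷ folded refl s≤ s≤′ ∷ []
    where s≤′ = ℕ.≤-trans s≤ (ℕ.m≤n+m _ 2)
  twin-nbrs (top M true) s≤ = twins other ∷ folded refl s≤′ s≤ ∷ folded refl s≤′ s≤ ∷ []
    where s≤′ = ℕ.≤-trans s≤ (ℕ.m≤n+m _ 2)
  twin-nbrs (top L b) s≤ = twins other ∷ twins other ∷ twins itself ∷ []
  twin-nbrs (top R b) s≤ = twins other ∷ twins other ∷ twins itself ∷ []
  twin-nbrs (C b)     s≤ = twins other ∷ twins other ∷ twins other ∷ []
  twin-nbrs (hub k)   s≤ = Unfolded-refl* _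

  -- The only possible node as deep as the tops of `L` and `R` is in `M`, for `m = r + 1`. It has
  -- position 1, so the wave has already passed it.
  tall-node : ∀ {s} a .(i≤ : suc r ≤ last a) b → 1 ≤ s → ¬ suc s ≤ pos (node a (suc r) i≤ b)
  tall-node M i≤ b 1≤s s≤ = ℕ.1+n≰n (ℕ.≤-trans (s≤s 1≤s)
    (ℕ.≤-trans s≤ (ℕ.≤-reflexive (cong suc (ℕ.m≤n⇒m∸n≡0 m≤1+r)))))
  tall-node L i≤ b _ _ = ℕ.1+n≰n (recompute (suc r ≤? r) i≤)
  tall-node R i≤ b _ _ = ℕ.1+n≰n (recompute (suc r ≤? r) i≤)

  Unfolded-suc : ∀ {s} v w → 1 ≤ s → s ≤ suc o → Unfolded (suc s) v w →
    Pointwise (Unfolded s) (nbrs v) (nbrs w)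
  Unfolded-suc v .v 1≤s s≤ (twins itself) = Unfolded-refl* _
  Unfolded-suc v .(twin v) 1≤s s≤ (twins other) = twin-nbrs v s≤
  Unfolded-suc v@(node a i i≤ b) w@(node a′ .i i≤′ b′) 1≤s s≤ (folded refl p q) =
    folded* (trans (map-depth-nbrs v) (Eq.sym (map-depth-nbrs w)))
      (All.map (λ l → ℕ.≤-pred (ℕ.≤-trans p l)) (pos-node a i i≤ b))
      (All.map (λ l → ℕ.≤-pred (ℕ.≤-trans q l)) (pos-node a′ i i≤′ b′))
  Unfolded-suc (node a i i≤ b) (top L _) 1≤s s≤ (folded refl p q) = contradiction p (tall-node a i≤ b 1≤s)
  Unfolded-suc (node a i i≤ b) (top R _) 1≤s s≤ (folded refl p q) = contradiction p (tall-node a i≤ b 1≤s)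
  Unfolded-suc (top L _) (node a i i≤ b) 1≤s s≤ (folded refl p q) = contradiction q (tall-node a i≤ b 1≤s)
  Unfolded-suc (top R _) (node a i i≤ b) 1≤s s≤ (folded refl p q) = contradiction q (tall-node a i≤ b 1≤s)
  Unfolded-suc (node a i i≤ b) (C _) 1≤s s≤ (folded refl p q) = contradiction (node≤ a i i≤) ℕ.1+n≰n
  Unfolded-suc (C _) (node a i i≤ b) 1≤s s≤ (folded refl p q) = contradiction (node≤ a i i≤) ℕ.1+n≰n
  Unfolded-suc (top L b) (top L b′) 1≤s s≤ (folded _ p q) =
    folded refl (ℕ.≤-pred p) (ℕ.≤-pred q) ∷ folded refl s≤C s≤C ∷ twins itself ∷ []
    where s≤C = ℕ.≤-trans s≤ (ℕ.n≤1+n _)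
  -- The third neighbours are the two vertices at the start, which are twins and not yet told apart.
  Unfolded-suc (top L b) (top R b′) 1≤s s≤ (folded _ p q) =
    folded refl (ℕ.≤-pred p) s≤R ∷ folded refl s≤C s≤C ∷ twins other ∷ []
    where s≤C = ℕ.≤-trans s≤ (ℕ.n≤1+n _)
          s≤R = ℕ.≤-trans s≤ (ℕ.+-monoˡ-≤ o {1} {4 + (r ∸ r)} (s≤s z≤n))
  Unfolded-suc (top R b) (top L b′) 1≤s s≤ (folded _ p q) =
    folded refl s≤R (ℕ.≤-pred q) ∷ folded refl s≤C s≤C ∷ twins other ∷ []
    where s≤C = ℕ.≤-trans s≤ (ℕ.n≤1+n _)
          s≤R = ℕ.≤-trans s≤ (ℕ.+-monoˡ-≤ o {1} {4 + (r ∸ r)} (s≤s z≤n))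
  Unfolded-suc (top R b) (top R b′) 1≤s s≤ (folded _ p q) =
    folded refl s≤R s≤R ∷ folded refl s≤C s≤C ∷ twins itself ∷ []
    where s≤C = ℕ.≤-trans s≤ (ℕ.n≤1+n _)
          s≤R = ℕ.≤-trans s≤ (ℕ.+-monoˡ-≤ o {1} {4 + (r ∸ r)} (s≤s z≤n))
  Unfolded-suc (C _) (top M _) 1≤s s≤ (folded _ _ ())
  Unfolded-suc (C _) (top L _) 1≤s s≤ (folded () _ _)
  Unfolded-suc (C _) (top R _) 1≤s s≤ (folded () _ _)
  Unfolded-suc (C b) (C b′) 1≤s s≤ (folded _ p q) = folded* refl
    (s≤ ∷ ℕ.≤-trans s≤ (ℕ.m≤n+m _ 2) ∷ ℕ.≤-trans s≤ (ℕ.n≤1+n _) ∷ [])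
    (s≤ ∷ ℕ.≤-trans s≤ (ℕ.m≤n+m _ 2) ∷ ℕ.≤-trans s≤ (ℕ.n≤1+n _) ∷ [])
  Unfolded-suc (hub _) (hub _) 1≤s s≤ (folded _ p q) = Unfolded-refl* _

  -- Only for m = r + 1 is there a node, M (r + 1), of the depth of the tops of L and R; it sees its twin,
  -- at its own depth, where they see the top of M, one level deeper.
  Unfolded-first : ∀ v w → Unfolded 1 v w → Pointwise (Folded (2 + r)) (nbrs v) (nbrs w)
  Unfolded-first v w u = Folded-nbrs v w (case v w u)
    where
    tall : ∀ a .(i≤ : suc r ≤ last a) → r ≤ m
    tall M i≤ = ℕ.<⇒≤ (recompute (suc r ≤? m) i≤)
    tall L i≤ = contradiction (recompute (suc r ≤? r) i≤) ℕ.1+n≰n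
    tall R i≤ = contradiction (recompute (suc r ≤? r) i≤) ℕ.1+n≰n
    third : ∀ a .(i≤ : suc r ≤ last a) → Trunc (2 + r) (2 + r) (2 + m)
    third a i≤ = inj₂ (ℕ.≤-refl , s≤s (s≤s (tall a i≤)))
    case : ∀ v w → Unfolded 1 v w → Pointwise (Trunc (2 + r)) (depths v) (depths w)
    case v .v        (twins itself) = trunc-refl* _
    case v .(twin v) (twins other)  = subst (Pointwise _ (depths v)) (depths-twin v) (trunc-refl* _)
    case (node a i _ _) (node a′ .i _ _) (folded refl _ _) = trunc-refl* _
    case (node a i i≤ b) (top L _) (folded refl _ _) = inj₁ refl ∷ inj₁ refl ∷ third a i≤ ∷ []
    case (node a i i≤ b) (top R _) (folded refl _ _) = inj₁ refl ∷ inj₁ refl ∷ third a i≤ ∷ []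
    case (top L _) (node a i i≤ b) (folded refl _ _) = inj₁ refl ∷ inj₁ refl ∷ trunc-sym (third a i≤) ∷ []
    case (top R _) (node a i i≤ b) (folded refl _ _) = inj₁ refl ∷ inj₁ refl ∷ trunc-sym (third a i≤) ∷ []
    case (node a i i≤ b) (C _) (folded refl p q) = contradiction (node≤ a i i≤) ℕ.1+n≰n
    case (C _) (node a i i≤ b) (folded refl p q) = contradiction (node≤ a i i≤) ℕ.1+n≰n
    case (top L _) (top L _) (folded _ _ _) = trunc-refl* _
    case (top L _) (top R _) (folded _ _ _) = trunc-refl* _
    case (top R _) (top L _) (folded _ _ _) = trunc-refl* _
    case (top R _) (top R _) (folded _ _ _) = trunc-refl* _
    case (C _) (top M _) (folded _ _ ())
    case (C _) (top L _) (folded () _ _)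
    case (C _) (top R _) (folded () _ _)
    case (C _) (C _) (folded _ _ _) = trunc-refl* _
    case (hub _) (hub _) (folded _ _ _) = trunc-refl* _

  Unfolded-pred : ∀ {s v w} → Unfolded (suc s) v w → Unfolded s v w
  Unfolded-pred (twins t)      = twins t
  Unfolded-pred (folded e p q) = folded e (ℕ.<⇒≤ p) (ℕ.<⇒≤ q)

  Unfolded⇒depth : ∀ {s v w} → Unfolded s v w → depth v ≡ depth w
  Unfolded⇒depth (twins t)      = depth-twin t
  Unfolded⇒depth (folded e _ _) = e

  -- The counterpart of `Unfolded` for the second wave, which splits the pairs themselves: those
  -- from position `s` on are still intact.
  data Paired (s : ℕ) (v : V) : V → Set where
    itself : Paired s v v
    pair   : ∀ {w} → w ≡ twin v → s ≤ pos v → Paired s v w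

  Paired-pred : ∀ {s v w} → Paired (suc s) v w → Paired s v w
  Paired-pred itself     = itself
  Paired-pred (pair e p) = pair e (ℕ.<⇒≤ p)

  Paired⇒Twin : ∀ {s v w} → Paired s v w → Twin v w
  Paired⇒Twin itself        = itself
  Paired⇒Twin (pair refl _) = other

  Paired-suc : ∀ {s} v w → Paired (suc s) v w → Pointwise (Paired s) (nbrs v) (nbrs w)
  Paired-suc v .v itself = Pointwise-diag (nbrs v) λ _ → itself
  Paired-suc v@(node a zero i≤ b) _ (pair refl p) with pos-node a zero i≤ b
  ... | l₁ ∷ l₂ ∷ _ = pair (twin-base a b) (ℕ.≤-pred (ℕ.≤-trans p l₁))
    ∷ pair (twin-at a 1 b) (ℕ.≤-pred (ℕ.≤-trans p l₂)) ∷ Pointwise-diag hubs λ _ → itself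
  Paired-suc v@(node a (suc i) i≤ b) _ (pair refl p) with pos-node a (suc i) i≤ b
  ... | l₁ ∷ l₂ ∷ l₃ ∷ [] = pair refl (ℕ.≤-pred (ℕ.≤-trans p l₁))
    ∷ pair (twin-at a (2 + i) b) (ℕ.≤-pred (ℕ.≤-trans p l₂)) ∷ pair refl (ℕ.≤-pred (ℕ.≤-trans p l₃)) ∷ []
  -- Twins among the tops share their neighbour at the start, so its split does not jump ahead to
  -- them.
  Paired-suc (top L b) _ (pair refl p) =
    pair refl (ℕ.≤-pred p) ∷ pair refl (ℕ.≤-trans (ℕ.≤-pred p) (ℕ.m≤n+m _ 2)) ∷ itself ∷ []
  Paired-suc (top R b) _ (pair refl p) =
    pair refl (ℕ.≤-trans (ℕ.≤-pred p) (ℕ.+-monoˡ-≤ o {2} {4 + (r ∸ r)} (s≤s (s≤s z≤n)))) ∷ pair refl (ℕ.≤-pred p) ∷ itself ∷ []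
  Paired-suc (C b) _ (pair refl p) =
    pair refl (ℕ.≤-pred p) ∷ pair refl (ℕ.≤-trans (ℕ.≤-pred p) (ℕ.m≤n+m _ 2))
      ∷ pair refl (ℕ.≤-trans (ℕ.≤-pred p) (ℕ.n≤1+n _)) ∷ []
  Paired-suc (hub k) _ (pair refl p) = Pointwise-diag (nbrs (hub k)) λ _ → itself

  -- Without a hub no vertex has depth 0, so truncation at 1 already merges everything in round 0.
  -- The offset `c`, complementary to `h`, records this head start.
  module Refinement (Alike : ℕ → V → V → Set) (alike-zero : ∀ {v w} → Alike 0 v w)
    (alike-suc : ∀ i {v w} → Alike i v w → Pointwise (Alike i) (nbrs v) (nbrs w) → Alike (suc i) v w)
    (c : ℕ) (c+h≡1 : c + h ≡ 1) where

    alike-folded : ∀ i v w → i + c ≤ 2 + r → Folded (i + c) v w → Alike i v w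
    alike-folded zero    v w _ _ = alike-zero
    alike-folded (suc i) v w (s≤s i≤) f = alike-suc i
      (alike-folded i v w (ℕ.m≤n⇒m≤1+n i≤) (Folded-pred {i + c} {v} {w} f))
      (Pointwise.map (λ {x} {y} → alike-folded i x y (ℕ.m≤n⇒m≤1+n i≤))
        (Folded-suc (i + c) v w i≤ (positive c c+h≡1) f))
      where
      positive : ∀ c → c + h ≡ 1 → 1 ≤ i + c ⊎ h ≡ 1
      positive zero    e = inj₂ e
      positive (suc c) e = inj₁ (ℕ.≤-trans (s≤s z≤n) (ℕ.m≤n+m (suc c) i))

    -- The last round of the depth phase: depths are truncated at `2 + r`, the depth of the tops of
    -- `L` and `R`.
    i₀ : ℕ
    i₀ = suc (r + h)

    i₀+c : i₀ + c ≡ 2 + r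
    i₀+c = cong suc (trans (ℕ.+-assoc r h c) (trans (cong (r +_) (trans (ℕ.+-comm h c) c+h≡1)) (ℕ.+-comm r 1)))

    -- The first wave advances by at most one position per round; `Unfolded-first` is the transition
    -- from depths to positions.
    alike-unfolded : ∀ s v w → s ≤ o → Unfolded (suc s) v w → Alike (suc s + i₀) v w
    alike-unfolded zero v w _ u = alike-suc i₀
      (alike-folded i₀ v w (ℕ.≤-reflexive i₀+c) (inj₁ (Unfolded⇒depth {1} {v} {w} u)))
      (Pointwise.map (λ {x} {y} f → alike-folded i₀ x y (ℕ.≤-reflexive i₀+c)
          (subst (λ t → Folded t x y) (Eq.sym i₀+c) f))
        (Unfolded-first v w u))
    alike-unfolded (suc s) v w s< u = alike-suc (suc s + i₀)
      (alike-unfolded s v w (ℕ.<⇒≤ s<) (Unfolded-pred u))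
      (Pointwise.map (λ {x} {y} → alike-unfolded s x y (ℕ.<⇒≤ s<))
        (Unfolded-suc v w (s≤s z≤n) (ℕ.m≤n⇒m≤1+n s<) u))

    -- The second wave cannot start before the first has told the tops of `L` from those of `R`; so
    -- all pairs are intact in round `2 + o + i₀`, and from then on at most one position is lost per
    -- round.
    alike-paired : ∀ s v w → Paired s v w → Alike (s + (2 + o + i₀)) v w
    alike-paired zero v w p = alike-suc (suc o + i₀)
      (alike-unfolded o v w ℕ.≤-refl (twins (Paired⇒Twin p)))
      (Pointwise.map (λ {x} {y} → alike-unfolded o x y ℕ.≤-refl)
        (Unfolded-suc v w (s≤s z≤n) ℕ.≤-refl (twins (Paired⇒Twin p))))
    alike-paired (suc s) v w p = alike-suc (s + (2 + o + i₀))
      (alike-paired s v w (Paired-pred p))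
      (Pointwise.map (λ {x} {y} → alike-paired s x y) (Paired-suc v w p))

    end : Bool → V
    end = node R 0 z≤n

    alike-ends : Alike (4 + r + o + (2 + o + i₀)) (end false) (end true)
    alike-ends = alike-paired (4 + r + o) (end false) (end true) (pair refl ℕ.≤-refl)

  -- Injectivity of positions and edges to the previous position

  Inside : Place → Set
  Inside (lo k)  = k ≤ suc m
  Inside (mid k) = k ≤ r
  Inside (hi k)  = 1 ≤ k

  inside : ∀ v → Inside (place v)
  inside (node M i i≤ b) = s≤s (ℕ.m∸n≤m m i)
  inside (node L i i≤ b) = recompute (i ≤? r) i≤
  inside (node R i i≤ b) = s≤s z≤n
  inside (top M b)       = z≤n
  inside (top L b)       = s≤s z≤n
  inside (top R b)       = s≤s z≤n
  inside (C b)           = s≤s z≤n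
  inside (hub k)         = s≤s z≤n

  value-injective : ∀ p q → Inside p → Inside q → value p ≡ value q → p ≡ q
  value-injective (lo k)  (lo l)  _  _  e = cong lo e
  value-injective (mid k) (mid l) _  _  e = cong mid (ℕ.+-cancelʳ-≡ (2 + m) k l e)
  value-injective (hi k)  (hi l)  _  _  e = cong hi (ℕ.+-cancelʳ-≡ o k l e)
  value-injective (lo k)  (mid l) k≤ _  e = contradiction e (ℕ.<⇒≢ (ℕ.≤-trans (s≤s k≤) (ℕ.m≤n+m _ l)))
  value-injective (mid k) (lo l)  _  l≤ e =
    contradiction (Eq.sym e) (ℕ.<⇒≢ (ℕ.≤-trans (s≤s l≤) (ℕ.m≤n+m _ k)))
  value-injective (lo k)  (hi l)  k≤ _  e =
    contradiction e (ℕ.<⇒≢ (ℕ.≤-trans (s≤s k≤) (ℕ.≤-trans (ℕ.m≤n+m _ r) (ℕ.m≤n+m o l))))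
  value-injective (hi k)  (lo l)  _  l≤ e =
    contradiction (Eq.sym e) (ℕ.<⇒≢ (ℕ.≤-trans (s≤s l≤) (ℕ.≤-trans (ℕ.m≤n+m _ r) (ℕ.m≤n+m o k))))
  value-injective (mid k) (hi l)  k≤ 1≤l e =
    contradiction e (ℕ.<⇒≢ (ℕ.≤-trans (s≤s (ℕ.+-monoˡ-≤ (2 + m) k≤)) (ℕ.+-monoˡ-≤ o 1≤l)))
  value-injective (hi k)  (mid l) 1≤k l≤ e =
    contradiction (Eq.sym e) (ℕ.<⇒≢ (ℕ.≤-trans (s≤s (ℕ.+-monoˡ-≤ (2 + m) l≤)) (ℕ.+-monoˡ-≤ o 1≤k)))

  lo-injective : ∀ {k l} → lo k ≡ lo l → k ≡ l
  lo-injective refl = refl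

  hi-injective : ∀ {k l} → hi k ≡ hi l → k ≡ l
  hi-injective refl = refl

  Twin-node : ∀ {a i j} .{i≤ : i ≤ last a} .{j≤ : j ≤ last a} b b′ → i ≡ j →
    Twin (node a i i≤ b) (node a j j≤ b′)
  Twin-node false false refl = itself
  Twin-node false true  refl = other
  Twin-node true  false refl = other
  Twin-node true  true  refl = itself

  Twin-top : ∀ {a} b b′ → Twin (top a b) (top a b′)
  Twin-top false false = itself
  Twin-top false true  = other
  Twin-top true  false = other
  Twin-top true  true  = itself

  Twin-C : ∀ b b′ → Twin (C b) (C b′)
  Twin-C false false = itself
  Twin-C false true  = other
  Twin-C true  false = other
  Twin-C true  true  = itself

  -- All hubs share one place, hence the condition on `w`.
  pos-injective : ∀ {v w} → depth w ≢ 0 → pos v ≡ pos w → Twin v w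
  pos-injective {v} {w} d e = case v w d (value-injective (place v) (place w) (inside v) (inside w) e)
    where
    case : ∀ v w → depth w ≢ 0 → place v ≡ place w → Twin v w
    case (node M i i≤ b) (node M j j≤ b′) _ e =
      Twin-node b b′ (ℕ.∸-cancelˡ-≡ (recompute (i ≤? m) i≤) (recompute (j ≤? m) j≤)
        (ℕ.suc-injective (lo-injective e)))
    case (node R i i≤ b) (node R j j≤ b′) _ e =
      Twin-node b b′ (ℕ.∸-cancelˡ-≡ (recompute (i ≤? r) i≤) (recompute (j ≤? r) j≤)
        (ℕ.+-cancelˡ-≡ 4 _ _ (hi-injective e)))
    case (node L i i≤ b) (node L .i j≤ b′) _ refl = Twin-node b b′ refl
    case (top M b) (top M b′) _ refl = Twin-top b b′
    case (top L b) (top L b′) _ refl = Twin-top b b′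
    case (top R b) (top R b′) _ refl = Twin-top b b′
    case (C b) (C b′) _ refl = Twin-C b b′
    case (node M _ _ _) (top M _) _ ()
    case (node M _ _ _) (top L _) _ ()
    case (node M _ _ _) (top R _) _ ()
    case (node L _ _ _) (top M _) _ ()
    case (node L _ _ _) (top L _) _ ()
    case (node L _ _ _) (top R _) _ ()
    case (node R _ _ _) (top M _) _ ()
    case (node R _ _ _) (top L _) _ ()
    case (node R _ _ _) (top R _) _ ()
    case (top M _) (node M _ _ _) _ ()
    case (top M _) (node L _ _ _) _ ()
    case (top M _) (node R _ _ _) _ ()
    case (top L _) (node M _ _ _) _ ()
    case (top L _) (node L _ _ _) _ ()
    case (top L _) (node R _ _ _) _ ()
    case (top R _) (node M _ _ _) _ ()
    case (top R _) (node L _ _ _) _ ()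
    case (top R _) (node R _ _ _) _ ()
    case (C _) (node M _ _ _) _ ()
    case (C _) (node L _ _ _) _ ()
    case (C _) (node R _ _ _) _ ()
    case (C _) (top M _) _ ()
    case (C _) (top L _) _ ()
    case (C _) (top R _) _ ()
    case (hub _) (top M _) _ ()
    case (hub _) (top L _) _ ()
    case (hub _) (top R _) _ ()
    case v (hub _) d _ = contradiction refl d
    case (hub _) (node R i i≤ b) d e = contradiction (hi-injective e)
      (ℕ.<⇒≢ (ℕ.≤-trans (ℕ.+-monoʳ-≤ 5 (ℕ.m∸n≤m r i)) (ℕ.≤-refl {5 + r})) ∘ Eq.sym)

  side : V → Bool
  side (node a i i≤ b) = b
  side (top a b)       = b
  side (C b)           = b
  side (hub k)         = false

  side-at : ∀ a i b → side (at a i b) ≡ b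
  side-at a i b with i ≤? last a
  ... | yes _ = refl
  ... | no  _ = refl

  prev : ∀ v {p} → pos v ≡ suc p → depth v ≢ 0 → ∃[ x ] (x ∈ nbrs v × depth x ≢ 0 × pos x ≡ p)
  prev v {p} e d = case v e d
    where
    pos-prev : ∀ a i .(i≤ : i ≤ last a) b → a ≢ L → suc (pos (at a (suc i) b)) ≡ pos (node a i i≤ b)
    pos-prev a i i≤ b ne with at a (suc i) b | next-view a i i≤ b
    pos-prev M i i≤ b ne | _ | inner i< =
      cong suc (Eq.sym (ℕ.+-∸-assoc 1 (recompute (suc i ≤? m) i<)))
    pos-prev L i i≤ b ne | _ | _ = contradiction refl ne
    pos-prev R i i≤ b ne | _ | inner i< =
      cong (λ k → 4 + k + o) (Eq.sym (ℕ.+-∸-assoc 1 (recompute (suc i ≤? r) i<)))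
    pos-prev M i i≤ b ne | _ | outer = cong suc (Eq.sym (ℕ.n∸n≡0 m))
    pos-prev R i i≤ b ne | _ | outer = cong (λ k → 4 + k + o) (Eq.sym (ℕ.n∸n≡0 r))
    above≢0 : ∀ a i .(i≤ : i ≤ last a) b → depth (at a (suc i) b) ≢ 0
    above≢0 a i i≤ b d = contradiction (trans (Eq.sym (depth-at a i i≤ b)) d) λ ()
    case : ∀ v → pos v ≡ suc p → depth v ≢ 0 → ∃[ x ] (x ∈ nbrs v × depth x ≢ 0 × pos x ≡ p)
    case (node M i i≤ b) e _ =
      _ , ∈-above M i i≤ b , above≢0 M i i≤ b , ℕ.suc-injective (trans (pos-prev M i i≤ b λ ()) e)
    case (node R i i≤ b) e _ =
      _ , ∈-above R i i≤ b , above≢0 R i i≤ b , ℕ.suc-injective (trans (pos-prev R i i≤ b λ ()) e)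
    case (node L zero i≤ b)    e _ = _ , here refl , (λ ()) , ℕ.suc-injective e
    case (node L (suc i) i≤ b) e _ = _ , here refl , (λ ()) , ℕ.suc-injective e
    case (top L b)             e _ = _ , here refl , (λ ()) , ℕ.suc-injective e
    case (top R b)             e _ = _ , there (here refl) , (λ ()) , ℕ.suc-injective e
    case (C b)                 e _ = _ , here refl , (λ ()) , ℕ.suc-injective e
    case (hub k)               e d = contradiction refl d

  -- The last alternative stands for the edges from the start of the path to the tops of L and R.
  adjacent-pos : ∀ w {y} → y ∈ nbrs w →
    depth w ≡ 0 ⊎ pos w ≤ suc (pos y) ⊎ (∃[ a ] ∃[ b ] ∃[ b′ ] (a ≢ M × w ≡ top a b × y ≡ top M b′))
  adjacent-pos (node a i i≤ b) y∈ = inj₂ (inj₁ (All.lookup (pos-node a i i≤ b) y∈))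
  adjacent-pos (top M b) y∈ = inj₂ (inj₁ z≤n)
  adjacent-pos (top L b) (here refl) = inj₂ (inj₁ ℕ.≤-refl)
  adjacent-pos (top L b) (there (here refl)) = inj₂ (inj₁ (ℕ.m≤n+m _ 2))
  adjacent-pos (top L b) (there (there (here refl))) = inj₂ (inj₂ (L , b , false , (λ ()) , refl , refl))
  adjacent-pos (top R b) (here refl) = inj₂ (inj₁ (ℕ.≤-trans (ℕ.n≤1+n _) (ℕ.≤-trans (ℕ.n≤1+n _)
    (s≤s (ℕ.+-monoˡ-≤ o {4} {4 + (r ∸ r)} (s≤s (s≤s (s≤s (s≤s z≤n)))))))))
  adjacent-pos (top R b) (there (here refl)) = inj₂ (inj₁ ℕ.≤-refl)
  adjacent-pos (top R b) (there (there (here refl))) = inj₂ (inj₂ (R , b , true , (λ ()) , refl , refl))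
  adjacent-pos (C b) (here refl) = inj₂ (inj₁ ℕ.≤-refl)
  adjacent-pos (C b) (there (here refl)) = inj₂ (inj₁ (ℕ.m≤n+m _ 2))
  adjacent-pos (C b) (there (there (here refl))) = inj₂ (inj₁ (ℕ.n≤1+n _))
  adjacent-pos (hub k) _ = inj₁ refl

  -- Consecutive pairs are joined by a matching that respects sides; inner edges stay at one
  -- position and do not qualify.
  prev-side : ∀ u {y} → y ∈ nbrs u → depth u ≢ 0 → pos u ≡ suc (pos y) → side y ≡ side u
  prev-side (node M zero i≤ b) (here refl) _ _ = refl
  prev-side (node L zero i≤ b) (here refl) _ _ = refl
  prev-side (node R zero i≤ b) (here refl) _ e = contradiction (Eq.sym e) ℕ.1+n≢n
  prev-side (node a zero i≤ b) (there (here refl)) _ _ = side-at a 1 b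
  prev-side (node a zero i≤ b) (there (there y∈)) _ e with ∈-map⁻ hub y∈
  ... | k , _ , refl = contradiction e (ℕ.<⇒≢ (s≤s (pos-hub a zero i≤ b)))
  prev-side (node a (suc i) i≤ b) (here refl) _ _ = refl
  prev-side (node a (suc i) i≤ b) (there (here refl)) _ _ = side-at a (2 + i) b
  prev-side (node a (suc i) i≤ b) (there (there (here refl))) _ e =
    contradiction (trans (Eq.sym e) (pos-twin {node a (suc i) i≤ b} other)) ℕ.1+n≢n
  prev-side (top L b) (here refl) _ _ = refl
  prev-side (top L b) (there (here refl)) _ _ = refl
  prev-side (top L b) (there (there (here refl))) _ e =
    contradiction (ℕ.m+n≡0⇒n≡0 r (ℕ.suc-injective e)) λ ()
  prev-side (top R b) (here refl) _ _ = refl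
  prev-side (top R b) (there (here refl)) _ _ = refl
  prev-side (top R b) (there (there (here refl))) _ e = contradiction (ℕ.suc-injective e) λ ()
  prev-side (C b) (here refl) _ _ = refl
  prev-side (C b) (there (here refl)) _ _ = refl
  prev-side (C b) (there (there (here refl))) _ e = contradiction (Eq.sym e) ℕ.1+n≢n
  prev-side (hub k) _ d _ = contradiction refl d

  -- Stable colourings split every pair

  module StableRelation (_≈_ : V → V → Set) (≈-sym : ∀ {v w} → v ≈ w → w ≈ v)
    (≈⇒degree : ∀ {v w} → v ≈ w → length (nbrs v) ≡ length (nbrs w))
    (≈⇒neighbour : ∀ {v w x} → v ≈ w → x ∈ nbrs v → ∃[ y ] (y ∈ nbrs w × x ≈ y))
    (h-cases : h ≡ 0 ⊎ h ≡ 1) where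

    length-nbrs : ∀ v → length (nbrs v) ≡ length (depths v)
    length-nbrs v = trans (Eq.sym (length-map depth (nbrs v))) (cong length (map-depth-nbrs v))

    ≈⇒depths : ∀ {v w} → v ≈ w → length (depths v) ≡ length (depths w)
    ≈⇒depths {v} {w} s = trans (Eq.sym (length-nbrs v)) (trans (≈⇒degree s) (length-nbrs w))

    ∈-depths : ∀ v {x} → x ∈ nbrs v → depth x ∈ depths v
    ∈-depths v x∈ = subst (_ ∈_) (map-depth-nbrs v) (∈-map⁺ depth x∈)

    degree-zero : h ≡ 0 ⊎ h ≡ 1 → 2 + length (tabulate {n = h} λ _ → 0) ≤ 3
    degree-zero (inj₁ refl) = ℕ.n≤1+n 2
    degree-zero (inj₂ refl) = ℕ.≤-refl

    hub-degree : ∀ w → 6 ≤ length (depths w) → depth w ≡ 0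
    hub-degree (node a zero _ _) l = contradiction (ℕ.≤-trans l (degree-zero h-cases)) λ { (s≤s (s≤s (s≤s ()))) }
    hub-degree (node a (suc i) _ _) (s≤s (s≤s (s≤s ())))
    hub-degree (top M _) (s≤s (s≤s (s≤s ())))
    hub-degree (top L _) (s≤s (s≤s (s≤s ())))
    hub-degree (top R _) (s≤s (s≤s (s≤s ())))
    hub-degree (C _) (s≤s (s≤s (s≤s ())))
    hub-degree (hub _) l = refl

    lower-neighbour : ∀ v k → depth v ≡ suc k → 1 ≤ k ⊎ h ≡ 1 → ∃[ x ] (x ∈ nbrs v × depth x ≡ k)
    lower-neighbour (node a zero _ _)    _ refl (inj₂ refl) = hub zero , there (there (here refl)) , refl
    lower-neighbour (node a (suc i) _ _) _ refl _ = _ , here refl , refl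
    lower-neighbour (top a _)            _ refl _ = _ , here refl , refl
    lower-neighbour (C _)                _ refl _ = _ , here refl , refl

    -- By induction, a neighbour of `v` one level down has a partner of the same depth next to `w`,
    -- and depth drops by at most one along an edge. This bounds the depth of `w` from above; if `w`
    -- is shallower, the induction hypothesis applies with the roles exchanged.
    depth-invariant : ∀ k {v w} → depth v ≤ k → v ≈ w → depth v ≡ depth w
    depth-invariant zero {hub _} {w} _ s = Eq.sym (hub-degree w (ℕ.≤-reflexive (≈⇒depths s)))
    depth-invariant (suc k) {v} {w} d≤ s with ℕ.m≤n⇒m<n∨m≡n d≤
    ... | inj₁ d<  = depth-invariant k (ℕ.≤-pred d<) s
    ... | inj₂ dv≡ with ℕ.≤-<-connex (depth w) k
    ...   | inj₁ dw≤ = Eq.sym (depth-invariant k dw≤ (≈-sym s))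
    ...   | inj₂ dw> = trans dv≡ (ℕ.≤-antisym dw> (upper k h-cases dv≡ (depth-invariant k)))
      where
      follow : ∀ k → depth v ≡ suc k → 1 ≤ k ⊎ h ≡ 1 →
        (∀ {x y} → depth x ≤ k → x ≈ y → depth x ≡ depth y) → depth w ≤ suc k
      follow k dv≡ pos rec with lower-neighbour v k dv≡ pos
      ... | x , x∈ , refl with ≈⇒neighbour s x∈
      ...   | y , y∈ , x≈y = subst (λ d → depth w ≤ suc d) (Eq.sym (rec ℕ.≤-refl x≈y))
        (All.lookup (depths-≥ w) (∈-depths w y∈))
      upper : ∀ k → h ≡ 0 ⊎ h ≡ 1 → depth v ≡ suc k →
        (∀ {x y} → depth x ≤ k → x ≈ y → depth x ≡ depth y) → depth w ≤ suc k
      upper k       (inj₂ h≡1) dv≡ rec = follow k dv≡ (inj₂ h≡1) rec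
      upper (suc k) (inj₁ h≡0) dv≡ rec = follow (suc k) dv≡ (inj₁ (s≤s z≤n)) rec
      -- Without a hub nothing lies below depth 1; degree 2 against 3 decides instead.
      upper zero    (inj₁ h≡0) dv≡ rec = ℕ.≮⇒≥ λ 1<dw →
        contradiction (trans (Eq.sym (two v dv≡ h≡0)) (trans (≈⇒depths s) (length-depths w (inj₁ 1<dw)))) λ ()
        where
        two : ∀ v → depth v ≡ 1 → h ≡ 0 → length (depths v) ≡ 2
        two (node a zero _ _) _ refl = refl

    ≈⇒depth : ∀ {v w} → v ≈ w → depth v ≡ depth w
    ≈⇒depth {v} {w} = depth-invariant (depth v) {v} {w} ℕ.≤-refl

    IsTop : Arm → V → Set
    IsTop a v = ∃[ b ] v ≡ top a b

    -- The rivals of `top M` depend on `near`: nodes for `suc m ≡ r`, tops of `L` and `R` for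
    -- `m ≡ r`, and `C` for `m ≡ suc r`. Nodes and `C` are betrayed by their twin, tops by `C`.
    topM-or : ∀ w → depth w ≡ 2 + m →
      IsTop M w ⊎ ∃[ x ] (x ∈ nbrs w × depth x ≢ 1 + m × depth x ≢ 2 + r)
    topM-or w d = case w d near
      where
      n≢2+n : ∀ n → n ≢ 2 + n
      n≢2+n n = ℕ.m≢1+n+m n
      Case : V → Set
      Case w = IsTop M w ⊎ ∃[ x ] (x ∈ nbrs w × depth x ≢ 1 + m × depth x ≢ 2 + r)
      case : ∀ w → depth w ≡ 2 + m → suc m ≡ r ⊎ m ≡ r ⊎ m ≡ suc r → Case w
      case (top M b) _ _ = inj₁ (b , refl)
      case (node a (suc i) i≤ b) refl (inj₁ refl) =
        inj₂ (_ , there (there (here refl)) , ℕ.1+n≢n , λ e → ℕ.1+n≢n (Eq.sym e))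
      case (node a (suc i) i≤ b) refl (inj₂ (inj₁ refl)) with a
      ... | M = contradiction (recompute (suc m ≤? m) i≤) ℕ.1+n≰n
      ... | L = contradiction (recompute (suc m ≤? m) i≤) ℕ.1+n≰n
      ... | R = contradiction (recompute (suc m ≤? m) i≤) ℕ.1+n≰n
      case (node a (suc i) i≤ b) refl (inj₂ (inj₂ refl)) = contradiction (node≤ a (suc i) i≤) ℕ.1+n≰n
      case (top L b) refl (inj₂ (inj₁ refl)) =
        inj₂ (_ , there (here refl) , (λ e → n≢2+n _ (Eq.sym e)) , ℕ.1+n≢n)
      case (top R b) refl (inj₂ (inj₁ refl)) =
        inj₂ (_ , there (here refl) , (λ e → n≢2+n _ (Eq.sym e)) , ℕ.1+n≢n)
      case (C b) refl (inj₂ (inj₂ refl)) =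
        inj₂ (_ , there (there (here refl)) , ℕ.1+n≢n , ℕ.1+n≢n)

    ≈topM : ∀ {w b} → top M b ≈ w → IsTop M w
    ≈topM {w} {b} s with topM-or w (Eq.sym (≈⇒depth s))
    ... | inj₁ t = t
    ... | inj₂ (x , x∈ , ≢1+m , ≢2+r) with ≈⇒neighbour (≈-sym s) x∈
    ...   | y , y∈ , x≈y with ∈-depths (top M b) y∈
    ...     | here e                 = contradiction (trans (≈⇒depth x≈y) e) ≢1+m
    ...     | there (here e)         = contradiction (trans (≈⇒depth x≈y) e) ≢2+r
    ...     | there (there (here e)) = contradiction (trans (≈⇒depth x≈y) e) ≢2+r

    -- Equal depths force the node to be M (r + 1); unlike the tops of L and R it has a neighbour, its
    -- twin, of its own depth.
    node≉top : ∀ {a i b a′ b′} .{i≤ : i ≤ last a} → a′ ≢ M → ¬ (node a i i≤ b ≈ top a′ b′)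
    node≉top {a} {i} {b} {a′} {b′} {i≤} a′≢M s = case a a′ a′≢M s (≈⇒depth {node a i i≤ b} {top a′ b′} s)
      where
      flip-depth : ∀ {d x ds} → x ∈ ds → x ≡ d → d ∈ ds
      flip-depth x∈ refl = x∈
      tall : ∀ a′ → a′ ≢ M → r < m → 2 + r ∉ topDepths a′
      tall M ne _ _ = ne refl
      tall L ne _ (here e) = ℕ.1+n≢n e
      tall L ne _ (there (here e)) = ℕ.1+n≢n (Eq.sym e)
      tall L ne r<m (there (there (here e))) = ℕ.<⇒≢ r<m (ℕ.suc-injective (ℕ.suc-injective e))
      tall R ne _ (here e) = ℕ.1+n≢n e
      tall R ne _ (there (here e)) = ℕ.1+n≢n (Eq.sym e)
      tall R ne r<m (there (there (here e))) = ℕ.<⇒≢ r<m (ℕ.suc-injective (ℕ.suc-injective e))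
      last-top : ∀ a → a ≢ M → last a ≡ r
      last-top M ne = contradiction refl ne
      last-top L ne = refl
      last-top R ne = refl
      short : ∀ a i .(i≤ : i ≤ last a) → i ≡ suc r → r < m
      short M i i≤ refl = recompute (suc r ≤? m) i≤
      short L i i≤ refl = contradiction (recompute (suc r ≤? r) i≤) ℕ.1+n≰n
      short R i i≤ refl = contradiction (recompute (suc r ≤? r) i≤) ℕ.1+n≰n
      twin-depth : ∀ {a i b w} .(i≤ : i ≤ last a) → i ≡ suc r → node a i i≤ b ≈ w → 2 + r ∈ depths w
      twin-depth {w = w} i≤ refl s with ≈⇒neighbour s (there (there (here refl)))
      ... | y , y∈ , x≈y = flip-depth (∈-depths w y∈) (Eq.sym (≈⇒depth x≈y))
      case : ∀ a a′ .{i≤ : i ≤ last a} → a′ ≢ M → node a i i≤ b ≈ top a′ b′ → suc i ≡ 2 + last a′ → ⊥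
      case a a′ {i≤} ne s d = tall a′ ne (short a i i≤ i≡) (twin-depth i≤ i≡ s)
        where
        i≡ : i ≡ suc r
        i≡ = trans (ℕ.suc-injective d) (cong suc (last-top a′ ne))

    pos-zero : ∀ v → pos v ≡ 0 → IsTop M v
    pos-zero v e with Twin-sym (pos-injective {v} {top M false} (λ ()) e)
    ... | itself = false , refl
    ... | other  = true , refl

    pos-one : ∀ v → pos v ≡ 1 → ∃[ b ] v ≡ node M m ℕ.≤-refl b
    pos-one v e with Twin-sym (pos-injective {v} {node M m ℕ.≤-refl false} (λ ())
      (trans e (cong suc (Eq.sym (ℕ.n∸n≡0 m)))))
    ... | itself = false , refl
    ... | other  = true , refl

    -- This is the first wave as an induction along the path: the predecessor of `v` has a partner
    -- `y` at its own position next to `w`, so `w` is at most one position further. If `w` lies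
    -- earlier, the roles are exchanged.
    pos-invariant : ∀ p {v w} → pos v ≤ p → depth v ≢ 0 → v ≈ w → Twin v w
    pos-invariant zero {v} p≤ d s with pos-zero v (ℕ.n≤0⇒n≡0 p≤)
    ... | b , refl with ≈topM s
    ...   | b′ , refl = Twin-top b b′
    pos-invariant (suc p) {v} {w} p≤ d s with ℕ.m≤n⇒m<n∨m≡n p≤
    ... | inj₁ p< = pos-invariant p (ℕ.≤-pred p<) d s
    ... | inj₂ pv with prev v pv d
    ...   | x , x∈ , dx , px with ≈⇒neighbour s x∈
    ...     | y , y∈ , x≈y = close (adjacent-pos w y∈)
      where
      py : pos y ≡ p
      py = trans (Eq.sym (pos-twin (pos-invariant p (ℕ.≤-reflexive px) dx x≈y))) px
      dw : depth w ≢ 0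
      dw e = d (trans (≈⇒depth s) e)
      close : depth w ≡ 0 ⊎ pos w ≤ suc (pos y)
        ⊎ (∃[ a ] ∃[ b ] ∃[ b′ ] (a ≢ M × w ≡ top a b × y ≡ top M b′)) → Twin v w
      close (inj₁ e) = contradiction e dw
      close (inj₂ (inj₁ pw)) with ℕ.m≤n⇒m<n∨m≡n (subst (λ q → pos w ≤ suc q) py pw)
      ... | inj₁ pw< = Twin-sym (pos-invariant p (ℕ.≤-pred pw<) dw (≈-sym s))
      ... | inj₂ pw≡ = pos-injective dw (trans pv (Eq.sym pw≡))
      -- The edge from the start to a top could carry the wave ahead. Then `p` is 0 and `v` is
      -- `node M m`, which `node≉top` tells from that top.
      close (inj₂ (inj₂ (a , b , b′ , ne , refl , refl))) with pos-one v (trans pv (cong suc (Eq.sym py)))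
      ... | b″ , refl = contradiction s (node≉top {b = b″} {b′ = b} ne)

    ≈⇒Twin : ∀ {v w} → depth v ≢ 0 → v ≈ w → Twin v w
    ≈⇒Twin {v} = pos-invariant (pos v) ℕ.≤-refl

    -- The second wave: at the start the twins see tops of different arms. Further on, a predecessor
    -- of `v` is matched either with its twin, against the induction hypothesis, or with itself,
    -- against `prev-side`.
    twins-apart : ∀ p {v} → pos v ≡ p → depth v ≢ 0 → ¬ (v ≈ twin v)
    twins-apart zero {v} e d s with pos-zero v e
    ... | false , refl = apart s
      where
      apart : ¬ (top M false ≈ top M true)
      apart s with ≈⇒neighbour s (there (here refl))
      ... | y , y∈ , x≈y with ≈⇒Twin {top L false} (λ ()) x≈y
      apart s | _ , there (here ()) , _ | itself
      apart s | _ , there (there (here ())) , _ | itself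
      apart s | _ , there (here ()) , _ | other
      apart s | _ , there (there (here ())) , _ | other
    ... | true , refl = apart s
      where
      apart : ¬ (top M true ≈ top M false)
      apart s with ≈⇒neighbour s (there (here refl))
      ... | y , y∈ , x≈y with ≈⇒Twin {top R false} (λ ()) x≈y
      apart s | _ , there (here ()) , _ | itself
      apart s | _ , there (there (here ())) , _ | itself
      apart s | _ , there (here ()) , _ | other
      apart s | _ , there (there (here ())) , _ | other
    twins-apart (suc p) {v} e d s with prev v e d
    ... | x , x∈ , dx , px with ≈⇒neighbour s x∈
    ...   | y , y∈ , x≈y with ≈⇒Twin dx x≈y
    ...     | other  = twins-apart p px dx x≈y
    ...     | itself = sides v d (trans (Eq.sym (prev-side v x∈ d pv))
      (prev-side (twin v) y∈ (λ d′ → d (trans (depth-twin {v} other) d′))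
        (trans (Eq.sym (pos-twin {v} other)) pv)))
      where
      pv : pos v ≡ suc (pos x)
      pv = trans e (cong suc (Eq.sym px))
      sides : ∀ v → depth v ≢ 0 → side v ≢ side (twin v)
      sides (node a i i≤ b) _ e = b≢not-b e
      sides (top a b)       _ e = b≢not-b e
      sides (C b)           _ e = b≢not-b e
      sides (hub k)         d _ = d refl

-- Orders from 14 on

complement-cases : ∀ c {h} → c + h ≡ 1 → h ≡ 0 ⊎ h ≡ 1
complement-cases zero    e = inj₂ e
complement-cases (suc c) e = inj₁ (ℕ.m+n≡0⇒n≡0 c (ℕ.suc-injective e))

module _ (m r h c : ℕ) (near : suc m ≡ r ⊎ m ≡ r ⊎ m ≡ suc r) (c+h≡1 : c + h ≡ 1) where

  open Family m r h near
  open NeighbourLists V↔Fin nbrs nbrs-unique nbrs-sym nbrs-irrefl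
  open Refinement Alike alike-zero alike-suc c c+h≡1

  -- If round `i` were stable, `Alike i` would satisfy the assumptions of `StableRelation` and
  -- separate the two ends, which `alike-ends` keeps together.
  family-unstable : ∀ i → i < suc (4 + r + o + (2 + o + i₀)) → ¬ Stable graph i
  family-unstable i i< stable = StableRelation.twins-apart (Alike i) alike-sym
    (λ s → alike⇒degree (alike-stable stable s)) (λ s → alike⇒neighbour (alike-stable stable s))
    (complement-cases c c+h≡1) (4 + r + o) {end false} refl (λ ())
    (alike-mono (ℕ.≤-pred i<) alike-ends)

  -- Hence the number of rounds shown to be unstable is `order` minus two.
  order≡ : order ≡ 3 + (4 + r + o + (2 + o + i₀))
  order≡ = solve 3 (λ m r h →
    (con 1 :+ m :+ (con 1 :+ r :+ (con 1 :+ r :+ con 4))) :* con 2 :+ h :=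
    con 3 :+ (con 4 :+ r :+ (r :+ (con 2 :+ m)) :+ (con 2 :+ (r :+ (con 2 :+ m)) :+ (con 1 :+ (r :+ h)))))
    refl m r h
    where open +-*-Solver

  attained-family : Attained ((7 + (m + 2 * r)) * 2 + h)
  attained-family = subst Attained (solve 3 (λ m r h →
    (con 1 :+ m :+ (con 1 :+ r :+ (con 1 :+ r :+ con 4))) :* con 2 :+ h :=
    (con 7 :+ (m :+ con 2 :* r)) :* con 2 :+ h) refl m r h)
    (attained-by (suc (4 + r + o + (2 + o + i₀))) order≡ graph family-unstable)
    where open +-*-Solver

-- With `m` equal to `r`, `r + 1` or `r - 1`, the sum `m + 2 * r` covers the residues 0, 1 and 2
-- modulo 3.
attained-2* : ∀ q h c → c + h ≡ 1 → Attained ((7 + q) * 2 + h)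
attained-2* q h c c+h≡1 with q divMod 3
... | result s zero refl = subst (λ k → Attained ((7 + k) * 2 + h))
  (solve 1 (λ s → s :+ con 2 :* s := s :* con 3) refl s)
  (attained-family s s h c (inj₂ (inj₁ refl)) c+h≡1)
  where open +-*-Solver
... | result s (suc zero) refl = subst (λ k → Attained ((7 + k) * 2 + h))
  (solve 1 (λ s → con 1 :+ s :+ con 2 :* s := con 1 :+ s :* con 3) refl s)
  (attained-family (suc s) s h c (inj₂ (inj₂ refl)) c+h≡1)
  where open +-*-Solver
... | result s (suc (suc zero)) refl = subst (λ k → Attained ((7 + k) * 2 + h))
  (solve 1 (λ s → s :+ con 2 :* (con 1 :+ s) := con 2 :+ s :* con 3) refl s)
  (attained-family s (suc s) h c (inj₁ refl) c+h≡1)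
  where open +-*-Solver

-- The parity of the order decides whether there is a hub.
attained-14+ : ∀ k → Attained (14 + k)
attained-14+ k with k divMod 2
... | result q zero refl = subst Attained (ℕ.+-identityʳ _) (attained-2* q 0 1 refl)
... | result q (suc zero) refl = subst Attained (ℕ.+-comm _ 1) (attained-2* q 1 0 refl)

theorem2 : ∀ (n : ℕ) → 10 ≤ n →
    ∃[ k ] (IsWL1Max n k × (k ≡ n ∸ 2 ⊎ k ≡ n ∸ 1))
theorem2 n 10≤n = Attained.proof (subst Attained (ℕ.m+[n∸m]≡n 10≤n) (case (n ∸ 10)))
  where
  case : ∀ k → Attained (10 + k)
  case 0 = attained₁₀
  case 1 = attained₁₁
  case 2 = attained₁₂
  case 3 = attained₁₃
  case (suc (suc (suc (suc k)))) = attained-14+ k
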